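{- Let $p=3$. There exist unique elements $q_0\equiv 7\pmod 9$ and $q_1\equiv 4\pmod 9$ in $U^{(1)}-U^{(2)}$ such that $\iota_{q_0}$ and $\iota_{q_1}$ have no nontrivial $3$-adic fixed points. If $q\in U^{(1)}-U^{(2)}$ and $q\notin\{q_0,q_1\}$, then $\iota_q$ has a unique nontrivial $3$-adic fixed point $z_q\in\mathbb{Z}_3$. For such $q$: if $q\in 4+9\mathbb{Z}_3$ then $z_q\in 1+3\mathbb{Z}_3$, and if $q\in 7+9\mathbb{Z}_3$ then $z_q\in 3\mathbb{Z}_3$.
   Context: $\mathbb{Z}_3$ is the ring of $3$-adic integers, $U^{(m)}=1+3^m\mathbb{Z}_3$, so $U^{(1)}-U^{(2)}=(4+9\mathbb{Z}_3)\cup(7+9\mathbb{Z}_3)$. For $q\in U^{(1)}$, $\iota_q:\mathbb{Z}_3\to\mathbb{Z}_3$ is the unique continuous function with $\iota_q(n)=1+q+\cdots+q^{n-1}$ for all integers $n\ge 0$; thus $\iota_q(z)=(q^z-1)/(q-1)$ for $q\ne 1$. A $3$-adic fixed point of $\iota_q$ is $z\in\mathbb{Z}_3$ with $\iota_q(z)=z$; the fixed points $0$ and $1$ (which every $\iota_q$ has) are called trivial, and all others nontrivial. -}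

module Defs where

open import Algebra.Bundles using (CommutativeRing; RawSemiring)
open import Algebra.Structures using (IsCommutativeRing)
import Algebra.Definitions.RawSemiring as RawSemiringDefs
open import Data.Integer.Base as ℤ using (ℤ; +_; _%ℕ_; _/ℕ_)
import Data.Integer.Properties as ℤ
open import Data.Integer.Divisibility.Signed using (_∣_; divides; *-cancelʳ-∣)
open import Data.Integer.DivMod using (a≡a%ℕn+[a/ℕn]*n)
open import Data.Integer.Tactic.RingSolver using (solve-∀)
open import Data.Nat.Base as ℕ using (ℕ; zero; suc)
import Data.Nat.Properties as ℕ
open import Data.Product.Base using (∃; _×_; _,_)
open import Data.Sum.Base using (inj₁; inj₂)
open import Level using (0ℓ)
open import Relation.Binary.PropositionalEquality
  using (_≡_; refl; sym; trans; cong; cong₂; subst; subst₂; module ≡-Reasoning)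
open import Relation.Nullary using (¬_)
open import Relation.Unary using (Pred; _∈_)

------------------------------------------------------------------------
-- Congruence of integers modulo 3ⁿ

infix 4 _≡_[3^_]

record _≡_[3^_] (a b : ℤ) (n : ℕ) : Set where
  constructor mk≡
  field 3ⁿ∣a-b : + (3 ℕ.^ n) ∣ a ℤ.- b

open _≡_[3^_] public

3^ : ℕ → ℤ
3^ n = + (3 ℕ.^ n)

abstract

  3^-+ : ∀ m n → 3^ (m ℕ.+ n) ≡ 3^ m ℤ.* 3^ n
  3^-+ m n = trans (cong +_ (ℕ.^-distribˡ-+-* 3 m n)) (ℤ.pos-* (3 ℕ.^ m) (3 ℕ.^ n))

infixl 7 _mod3^_

_mod3^_ : ℤ → ℕ → ℕ
a mod3^ n = _%ℕ_ a (3 ℕ.^ n) {{ℕ.m^n≢0 3 n}}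

module _ {n : ℕ} where

  abstract

    ≡ₙ-by : ∀ {a b} k → a ℤ.- b ≡ k ℤ.* + (3 ℕ.^ n) → a ≡ b [3^ n ]
    ≡ₙ-by k eq = mk≡ (divides k eq)

    ≡ₙ-reflexive : ∀ {a b} → a ≡ b → a ≡ b [3^ n ]
    ≡ₙ-reflexive {a} refl = ≡ₙ-by (+ 0) (lem a (3^ n))
      where
      lem : ∀ a P → a ℤ.- a ≡ + 0 ℤ.* P
      lem = solve-∀

    ≡ₙ-refl : ∀ {a} → a ≡ a [3^ n ]
    ≡ₙ-refl = ≡ₙ-reflexive refl

    ≡ₙ-sym : ∀ {a b} → a ≡ b [3^ n ] → b ≡ a [3^ n ]
    ≡ₙ-sym {a} {b} (mk≡ (divides k eq)) =
      ≡ₙ-by (ℤ.- k) (trans (lem₁ a b) (trans (cong ℤ.-_ eq) (lem₂ k (3^ n))))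
      where
      lem₁ : ∀ a b → b ℤ.- a ≡ ℤ.- (a ℤ.- b)
      lem₁ = solve-∀
      lem₂ : ∀ k P → ℤ.- (k ℤ.* P) ≡ (ℤ.- k) ℤ.* P
      lem₂ = solve-∀

    ≡ₙ-trans : ∀ {a b c} → a ≡ b [3^ n ] → b ≡ c [3^ n ] → a ≡ c [3^ n ]
    ≡ₙ-trans {a} {b} {c} (mk≡ (divides k eq)) (mk≡ (divides l eq′)) =
      ≡ₙ-by (k ℤ.+ l) (trans (lem₁ a b c) (trans (cong₂ ℤ._+_ eq eq′) (lem₂ k l (3^ n))))
      where
      lem₁ : ∀ a b c → a ℤ.- c ≡ (a ℤ.- b) ℤ.+ (b ℤ.- c)
      lem₁ = solve-∀
      lem₂ : ∀ k l P → k ℤ.* P ℤ.+ l ℤ.* P ≡ (k ℤ.+ l) ℤ.* P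
      lem₂ = solve-∀

    ≡ₙ-+-cong : ∀ {a b c d} → a ≡ b [3^ n ] → c ≡ d [3^ n ] → a ℤ.+ c ≡ b ℤ.+ d [3^ n ]
    ≡ₙ-+-cong {a} {b} {c} {d} (mk≡ (divides k eq)) (mk≡ (divides l eq′)) =
      ≡ₙ-by (k ℤ.+ l) (trans (lem₁ a b c d) (trans (cong₂ ℤ._+_ eq eq′) (lem₂ k l (3^ n))))
      where
      lem₁ : ∀ a b c d → (a ℤ.+ c) ℤ.- (b ℤ.+ d) ≡ (a ℤ.- b) ℤ.+ (c ℤ.- d)
      lem₁ = solve-∀
      lem₂ : ∀ k l P → k ℤ.* P ℤ.+ l ℤ.* P ≡ (k ℤ.+ l) ℤ.* P
      lem₂ = solve-∀

    ≡ₙ-*-cong : ∀ {a b c d} → a ≡ b [3^ n ] → c ≡ d [3^ n ] → a ℤ.* c ≡ b ℤ.* d [3^ n ]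
    ≡ₙ-*-cong {a} {b} {c} {d} (mk≡ (divides k eq)) (mk≡ (divides l eq′)) =
      ≡ₙ-by (k ℤ.* c ℤ.+ b ℤ.* l)
        (trans (lem₁ a b c d)
          (trans (cong₂ (λ u v → u ℤ.* c ℤ.+ b ℤ.* v) eq eq′) (lem₂ k l b c (3^ n))))
      where
      lem₁ : ∀ a b c d → a ℤ.* c ℤ.- b ℤ.* d ≡ (a ℤ.- b) ℤ.* c ℤ.+ b ℤ.* (c ℤ.- d)
      lem₁ = solve-∀
      lem₂ : ∀ k l b c P →
             (k ℤ.* P) ℤ.* c ℤ.+ b ℤ.* (l ℤ.* P) ≡ (k ℤ.* c ℤ.+ b ℤ.* l) ℤ.* P
      lem₂ = solve-∀

    ≡ₙ-neg-cong : ∀ {a b} → a ≡ b [3^ n ] → ℤ.- a ≡ ℤ.- b [3^ n ]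
    ≡ₙ-neg-cong {a} {b} (mk≡ (divides k eq)) =
      ≡ₙ-by (ℤ.- k) (trans (lem₁ a b) (trans (cong ℤ.-_ eq) (lem₂ k (3^ n))))
      where
      lem₁ : ∀ a b → (ℤ.- a) ℤ.- (ℤ.- b) ≡ ℤ.- (a ℤ.- b)
      lem₁ = solve-∀
      lem₂ : ∀ k P → ℤ.- (k ℤ.* P) ≡ (ℤ.- k) ℤ.* P
      lem₂ = solve-∀

abstract

  ≡ₙ-weaken : ∀ {m n a b} → n ℕ.≤ m → a ≡ b [3^ m ] → a ≡ b [3^ n ]
  ≡ₙ-weaken {m} {n} {a} {b} n≤m (mk≡ (divides k eq)) =
    ≡ₙ-by (k ℤ.* 3^ (m ℕ.∸ n)) (begin
      a ℤ.- b                          ≡⟨ eq ⟩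
      k ℤ.* 3^ m                       ≡⟨ cong (λ i → k ℤ.* 3^ i) (ℕ.m∸n+n≡m n≤m) ⟨
      k ℤ.* 3^ (m ℕ.∸ n ℕ.+ n)         ≡⟨ cong (k ℤ.*_) (3^-+ (m ℕ.∸ n) n) ⟩
      k ℤ.* (3^ (m ℕ.∸ n) ℤ.* 3^ n)    ≡⟨ ℤ.*-assoc k (3^ (m ℕ.∸ n)) (3^ n) ⟨
      k ℤ.* 3^ (m ℕ.∸ n) ℤ.* 3^ n      ∎)
    where open ≡-Reasoning

  mod3^-≡ₙ : ∀ n a → + (a mod3^ n) ≡ a [3^ n ]
  mod3^-≡ₙ n a = ≡ₙ-sym (≡ₙ-by d
    (trans (cong (λ u → u ℤ.- r) (a≡a%ℕn+[a/ℕn]*n a (3 ℕ.^ n) {{ℕ.m^n≢0 3 n}})) (lem r d (3^ n))))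
    where
    r d : ℤ
    r = + (a mod3^ n)
    d = _/ℕ_ a (3 ℕ.^ n) {{ℕ.m^n≢0 3 n}}
    lem : ∀ r q P → (r ℤ.+ q ℤ.* P) ℤ.- r ≡ q ℤ.* P
    lem = solve-∀

------------------------------------------------------------------------
-- ℤ₃ as the inverse limit of the rings ℤ/3ⁿℤ.  Residues are represented
-- by arbitrary integers, so equality of 3-adic integers is the setoid
-- equality _≈_, not propositional equality.

record ℤ₃ : Set where
  constructor mkℤ₃
  field
    approx   : ℕ → ℤ
    coherent : ∀ n → approx (suc n) ≡ approx n [3^ n ]

open ℤ₃ public

infix 4 _≈_

record _≈_ (x y : ℤ₃) : Set where
  constructor mk≈
  field ≈-at : ∀ n → approx x n ≡ approx y n [3^ n ]

open _≈_ public

fromℤ : ℤ → ℤ₃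
fromℤ a = mkℤ₃ (λ _ → a) (λ _ → ≡ₙ-refl)

fromℕ : ℕ → ℤ₃
fromℕ n = fromℤ (+ n)

infixl 7 _*_
infixl 6 _+_
infix  8 -_

_+_ : ℤ₃ → ℤ₃ → ℤ₃
x + y = mkℤ₃ (λ n → approx x n ℤ.+ approx y n)
             (λ n → ≡ₙ-+-cong (coherent x n) (coherent y n))

_*_ : ℤ₃ → ℤ₃ → ℤ₃
x * y = mkℤ₃ (λ n → approx x n ℤ.* approx y n)
             (λ n → ≡ₙ-*-cong (coherent x n) (coherent y n))

-_ : ℤ₃ → ℤ₃
- x = mkℤ₃ (λ n → ℤ.- approx x n) (λ n → ≡ₙ-neg-cong (coherent x n))

0# 1# : ℤ₃
0# = fromℤ (+ 0)
1# = fromℤ (+ 1)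

abstract

  ≈-refl : ∀ {x} → x ≈ x
  ≈-refl = mk≈ λ _ → ≡ₙ-refl

  ≈-sym : ∀ {x y} → x ≈ y → y ≈ x
  ≈-sym (mk≈ e) = mk≈ λ n → ≡ₙ-sym (e n)

  ≈-trans : ∀ {x y z} → x ≈ y → y ≈ z → x ≈ z
  ≈-trans (mk≈ e) (mk≈ f) = mk≈ λ n → ≡ₙ-trans (e n) (f n)

  isCommutativeRing : IsCommutativeRing _≈_ _+_ _*_ -_ 0# 1#
  isCommutativeRing = record
    { isRing = record
      { +-isAbelianGroup = record
        { isGroup = record
          { isMonoid = record
            { isSemigroup = record
              { isMagma = record
                { isEquivalence = record { refl = ≈-refl ; sym = ≈-sym ; trans = ≈-trans }
                ; ∙-cong = λ (mk≈ e) (mk≈ f) → mk≈ λ n → ≡ₙ-+-cong (e n) (f n)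
                }
              ; assoc = λ x y z → mk≈ λ n →
                  ≡ₙ-reflexive (ℤ.+-assoc (approx x n) (approx y n) (approx z n))
              }
            ; identity = (λ x → mk≈ λ n → ≡ₙ-reflexive (ℤ.+-identityˡ (approx x n)))
                       , (λ x → mk≈ λ n → ≡ₙ-reflexive (ℤ.+-identityʳ (approx x n)))
            }
          ; inverse = (λ x → mk≈ λ n → ≡ₙ-reflexive (ℤ.+-inverseˡ (approx x n)))
                    , (λ x → mk≈ λ n → ≡ₙ-reflexive (ℤ.+-inverseʳ (approx x n)))
          ; ⁻¹-cong = λ (mk≈ e) → mk≈ λ n → ≡ₙ-neg-cong (e n)
          }
        ; comm = λ x y → mk≈ λ n → ≡ₙ-reflexive (ℤ.+-comm (approx x n) (approx y n))
        }
      ; *-cong = λ (mk≈ e) (mk≈ f) → mk≈ λ n → ≡ₙ-*-cong (e n) (f n)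
      ; *-assoc = λ x y z → mk≈ λ n →
          ≡ₙ-reflexive (ℤ.*-assoc (approx x n) (approx y n) (approx z n))
      ; *-identity = (λ x → mk≈ λ n → ≡ₙ-reflexive (ℤ.*-identityˡ (approx x n)))
                   , (λ x → mk≈ λ n → ≡ₙ-reflexive (ℤ.*-identityʳ (approx x n)))
      ; distrib = (λ x y z → mk≈ λ n →
                    ≡ₙ-reflexive (ℤ.*-distribˡ-+ (approx x n) (approx y n) (approx z n)))
                , (λ x y z → mk≈ λ n →
                    ≡ₙ-reflexive (ℤ.*-distribʳ-+ (approx x n) (approx y n) (approx z n)))
      }
    ; *-comm = λ x y → mk≈ λ n → ≡ₙ-reflexive (ℤ.*-comm (approx x n) (approx y n))
    }

ℤ₃-commutativeRing : CommutativeRing 0ℓ 0ℓ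
ℤ₃-commutativeRing = record { isCommutativeRing = isCommutativeRing }

------------------------------------------------------------------------
-- a +⟨ m ⟩ is the coset a + mℤ₃

_+⟨_⟩ : ℤ₃ → ℕ → Pred ℤ₃ 0ℓ
(a +⟨ m ⟩) x = ∃ λ t → x ≈ a + fromℕ m * t

U : ℕ → Pred ℤ₃ 0ℓ
U m = 1# +⟨ 3 ℕ.^ m ⟩

abstract

  coherent-≤ : ∀ x {m n} → m ℕ.≤ n → approx x n ≡ approx x m [3^ m ]
  coherent-≤ x {m} m≤n = subst (λ i → approx x i ≡ approx x m [3^ m ])
                               (ℕ.m+[n∸m]≡n m≤n) (go _)
    where
    go : ∀ k → approx x (m ℕ.+ k) ≡ approx x m [3^ m ]
    go zero    = ≡ₙ-reflexive (cong (approx x) (ℕ.+-identityʳ m))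
    go (suc k) = ≡ₙ-trans (≡ₙ-reflexive (cong (approx x) (ℕ.+-suc m k)))
                   (≡ₙ-trans (≡ₙ-weaken (ℕ.m≤m+n m k) (coherent x (m ℕ.+ k))) (go k))

  ∈coset⇒≡ₙ : ∀ {m a x} → x ∈ a +⟨ 3 ℕ.^ m ⟩ → approx x m ≡ approx a m [3^ m ]
  ∈coset⇒≡ₙ {m} {a} (t , mk≈ e) = ≡ₙ-trans (e m) (≡ₙ-by (approx t m) (lem (approx a m) (3^ m) (approx t m)))
    where
    lem : ∀ a P t → (a ℤ.+ P ℤ.* t) ℤ.- a ≡ t ℤ.* P
    lem = solve-∀

  ≡ₙ⇒∈coset : ∀ {m a x} → approx x m ≡ approx a m [3^ m ] → x ∈ a +⟨ 3 ℕ.^ m ⟩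
  ≡ₙ⇒∈coset {m} {a} {x} e = t , mk≈ x≈
    where
    x≡a : ∀ n → approx x (n ℕ.+ m) ≡ approx a (n ℕ.+ m) [3^ m ]
    x≡a n = ≡ₙ-trans (coherent-≤ x (ℕ.m≤n+m m n))
                    (≡ₙ-trans e (≡ₙ-sym (coherent-≤ a (ℕ.m≤n+m m n))))

    q : ℕ → ℤ
    q n = _∣_.quotient (3ⁿ∣a-b (x≡a n))

    q-eq : ∀ n → approx x (n ℕ.+ m) ℤ.- approx a (n ℕ.+ m) ≡ q n ℤ.* 3^ m
    q-eq n = _∣_.equality (3ⁿ∣a-b (x≡a n))

    t : ℤ₃
    t = mkℤ₃ q λ n →
      mk≡ (*-cancelʳ-∣ (3^ m) {{ℕ.m^n≢0 3 m}}
        (subst₂ _∣_ (3^-+ n m)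
          (trans (cong₂ ℤ._-_ (q-eq (suc n)) (q-eq n)) (lem (q (suc n)) (q n) (3^ m)))
          (3ⁿ∣a-b (≡ₙ-+-cong (coherent x (n ℕ.+ m)) (≡ₙ-neg-cong (coherent a (n ℕ.+ m)))))))
      where
      lem : ∀ k l P → (k ℤ.* P) ℤ.- (l ℤ.* P) ≡ (k ℤ.- l) ℤ.* P
      lem = solve-∀

    x≈ : ∀ n → approx x n ≡ approx a n ℤ.+ 3^ m ℤ.* q n [3^ n ]
    x≈ n =
      ≡ₙ-trans (≡ₙ-sym (coherent-≤ x (ℕ.m≤m+n n m)))
        (≡ₙ-trans (≡ₙ-reflexive
          (trans (lem (approx x (n ℕ.+ m)) (approx a (n ℕ.+ m)))
            (trans (cong (λ u → approx a (n ℕ.+ m) ℤ.+ u) (q-eq n))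
              (cong (λ u → approx a (n ℕ.+ m) ℤ.+ u) (ℤ.*-comm (q n) (3^ m))))))
          (≡ₙ-+-cong (coherent-≤ a (ℕ.m≤m+n n m)) ≡ₙ-refl))
      where
      lem : ∀ u v → u ≡ v ℤ.+ (u ℤ.- v)
      lem = solve-∀

------------------------------------------------------------------------
-- geom q n = 1 + q + ⋯ + qⁿ⁻¹

module Geometric {c ℓ} (R : RawSemiring c ℓ) where
  open RawSemiring R using (Carrier)
    renaming (0# to 0R; _+_ to _+R_)
  open RawSemiringDefs R using (_^_)

  geom : Carrier → ℕ → Carrier
  geom q zero    = 0R
  geom q (suc n) = geom q n +R q ^ n

ℤ₃-rawSemiring : RawSemiring 0ℓ 0ℓ
ℤ₃-rawSemiring = record { _≈_ = _≈_ ; _+_ = _+_ ; _*_ = _*_ ; 0# = 0# ; 1# = 1# }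

open RawSemiringDefs ℤ.+-*-rawSemiring public using () renaming (_^_ to _^ℤ_)
open RawSemiringDefs ℤ₃-rawSemiring public using () renaming (_^_ to _^₃_)
open Geometric ℤ.+-*-rawSemiring public using () renaming (geom to geomℤ)
open Geometric ℤ₃-rawSemiring public using (geom)

abstract

  approx-geom : ∀ q k n → approx (geom q k) n ≡ geomℤ (approx q n) k
  approx-geom q zero    n = refl
  approx-geom q (suc k) n = cong₂ ℤ._+_ (approx-geom q k n) (approx-^ k)
    where
    approx-^ : ∀ k → approx (q ^₃ k) n ≡ approx q n ^ℤ k
    approx-^ zero    = refl
    approx-^ (suc k) = cong (approx q n ℤ.*_) (approx-^ k)

  ^-cong : ∀ {n a b} k → a ≡ b [3^ n ] → a ^ℤ k ≡ b ^ℤ k [3^ n ]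
  ^-cong zero    e = ≡ₙ-refl
  ^-cong (suc k) e = ≡ₙ-*-cong e (^-cong k e)

  1^ : ∀ k → (+ 1) ^ℤ k ≡ + 1
  1^ zero    = refl
  1^ (suc k) = trans (ℤ.*-identityˡ ((+ 1) ^ℤ k)) (1^ k)

  ^-+ : ∀ a m k → a ^ℤ (m ℕ.+ k) ≡ a ^ℤ m ℤ.* a ^ℤ k
  ^-+ a zero    k = sym (ℤ.*-identityˡ (a ^ℤ k))
  ^-+ a (suc m) k = trans (cong (a ℤ.*_) (^-+ a m k)) (sym (ℤ.*-assoc a (a ^ℤ m) (a ^ℤ k)))

  geomℤ-cong : ∀ {n a b} k → a ≡ b [3^ n ] → geomℤ a k ≡ geomℤ b k [3^ n ]
  geomℤ-cong zero    e = ≡ₙ-refl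
  geomℤ-cong (suc k) e = ≡ₙ-+-cong (geomℤ-cong k e) (^-cong k e)

  geomℤ-+ : ∀ a m k → geomℤ a (m ℕ.+ k) ≡ geomℤ a m ℤ.+ a ^ℤ m ℤ.* geomℤ a k
  geomℤ-+ a m zero = trans (cong (geomℤ a) (ℕ.+-identityʳ m)) (lem (geomℤ a m) (a ^ℤ m))
    where
    lem : ∀ g p → g ≡ g ℤ.+ p ℤ.* + 0
    lem = solve-∀
  geomℤ-+ a m (suc k) = begin
    geomℤ a (m ℕ.+ suc k)                                        ≡⟨ cong (geomℤ a) (ℕ.+-suc m k) ⟩
    geomℤ a (m ℕ.+ k) ℤ.+ a ^ℤ (m ℕ.+ k)                         ≡⟨ cong₂ ℤ._+_ (geomℤ-+ a m k) (^-+ a m k) ⟩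
    (geomℤ a m ℤ.+ a ^ℤ m ℤ.* geomℤ a k) ℤ.+ a ^ℤ m ℤ.* a ^ℤ k   ≡⟨ lem (geomℤ a m) (a ^ℤ m) (geomℤ a k) (a ^ℤ k) ⟩
    geomℤ a m ℤ.+ a ^ℤ m ℤ.* (geomℤ a k ℤ.+ a ^ℤ k)              ∎
    where
    open ≡-Reasoning
    lem : ∀ g p h r → (g ℤ.+ p ℤ.* h) ℤ.+ p ℤ.* r ≡ g ℤ.+ p ℤ.* (h ℤ.+ r)
    lem = solve-∀

  geomℤ-3^ : ∀ {a} n → a ≡ + 1 [3^ 1 ] → geomℤ a (3 ℕ.^ n) ≡ + 0 [3^ n ]
  geomℤ-3^ {a} zero    e = ≡ₙ-by (geomℤ a 1) (lem (geomℤ a 1))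
    where
    lem : ∀ g → g ℤ.- + 0 ≡ g ℤ.* + 1
    lem = solve-∀
  geomℤ-3^ {a} (suc n) e with geomℤ-3^ {a} n e
  ... | mk≡ (divides k eq) with ≡ₙ-trans (^-cong (3 ℕ.^ n) e) (≡ₙ-reflexive (1^ (3 ℕ.^ n)))
  ... | mk≡ (divides l eq′) = ≡ₙ-by (k ℤ.* c) (begin
    geomℤ a (3 ℕ.^ suc n) ℤ.- + 0           ≡⟨ ℤ.+-identityʳ _ ⟩
    geomℤ a (3 ℕ.^ suc n)                   ≡⟨ geomℤ-+ a M (M ℕ.+ (M ℕ.+ 0)) ⟩
    G ℤ.+ p ℤ.* geomℤ a (M ℕ.+ (M ℕ.+ 0))   ≡⟨ cong (λ u → G ℤ.+ p ℤ.* u) (geomℤ-+ a M (M ℕ.+ 0)) ⟩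
    G ℤ.+ p ℤ.* (G ℤ.+ p ℤ.* geomℤ a (M ℕ.+ 0))
                                            ≡⟨ cong (λ u → G ℤ.+ p ℤ.* (G ℤ.+ p ℤ.* geomℤ a u)) (ℕ.+-identityʳ M) ⟩
    G ℤ.+ p ℤ.* (G ℤ.+ p ℤ.* G)             ≡⟨ cong₂ (λ u v → u ℤ.+ v ℤ.* (u ℤ.+ v ℤ.* u)) G≡ p≡ ⟩
    k ℤ.* 3^ n ℤ.+ (+ 1 ℤ.+ l ℤ.* + 3) ℤ.* (k ℤ.* 3^ n ℤ.+ (+ 1 ℤ.+ l ℤ.* + 3) ℤ.* (k ℤ.* 3^ n))
                                            ≡⟨ lem k l (3^ n) ⟩
    k ℤ.* c ℤ.* (+ 3 ℤ.* 3^ n)              ≡⟨ cong (k ℤ.* c ℤ.*_) (ℤ.pos-* 3 M) ⟨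
    k ℤ.* c ℤ.* 3^ (suc n)                  ∎)
    where
    open ≡-Reasoning
    M : ℕ
    M = 3 ℕ.^ n
    G p c : ℤ
    G = geomℤ a M
    p = a ^ℤ M
    c = + 1 ℤ.+ + 3 ℤ.* l ℤ.+ + 3 ℤ.* l ℤ.* l
    G≡ : G ≡ k ℤ.* 3^ n
    G≡ = trans (sym (ℤ.+-identityʳ G)) eq
    p≡ : p ≡ + 1 ℤ.+ l ℤ.* + 3
    p≡ = trans (h p) (cong (λ u → + 1 ℤ.+ u) eq′)
      where
      h : ∀ p → p ≡ + 1 ℤ.+ (p ℤ.- + 1)
      h = solve-∀
    lem : ∀ k l P →
      k ℤ.* P ℤ.+ (+ 1 ℤ.+ l ℤ.* + 3) ℤ.* (k ℤ.* P ℤ.+ (+ 1 ℤ.+ l ℤ.* + 3) ℤ.* (k ℤ.* P)) ≡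
      k ℤ.* (+ 1 ℤ.+ + 3 ℤ.* l ℤ.+ + 3 ℤ.* l ℤ.* l) ℤ.* (+ 3 ℤ.* P)
    lem = solve-∀

  geomℤ-period* : ∀ {a} n b k → a ≡ + 1 [3^ 1 ] →
                  geomℤ a (b ℕ.+ k ℕ.* 3 ℕ.^ n) ≡ geomℤ a b [3^ n ]
  geomℤ-period* {a} n b zero    e = ≡ₙ-reflexive (cong (geomℤ a) (ℕ.+-identityʳ b))
  geomℤ-period* {a} n b (suc k) e =
    ≡ₙ-trans (≡ₙ-reflexive
        (trans (cong (geomℤ a) (trans (cong (b ℕ.+_) (ℕ.+-comm (3 ℕ.^ n) (k ℕ.* 3 ℕ.^ n)))
                                      (sym (ℕ.+-assoc b (k ℕ.* 3 ℕ.^ n) (3 ℕ.^ n)))))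
               (geomℤ-+ a (b ℕ.+ k ℕ.* 3 ℕ.^ n) (3 ℕ.^ n))))
      (≡ₙ-trans (≡ₙ-+-cong (geomℤ-period* n b k e)
                  (≡ₙ-*-cong (≡ₙ-refl {a = a ^ℤ (b ℕ.+ k ℕ.* 3 ℕ.^ n)}) (geomℤ-3^ n e)))
        (≡ₙ-reflexive (lem (geomℤ a b) (a ^ℤ (b ℕ.+ k ℕ.* 3 ℕ.^ n)))))
    where
    lem : ∀ g p → g ℤ.+ p ℤ.* + 0 ≡ g
    lem = solve-∀

  ≡ₙ⇒+* : ∀ {n} i j → + i ≡ + j [3^ n ] → j ℕ.≤ i → ∃ λ k → i ≡ j ℕ.+ k ℕ.* 3 ℕ.^ n
  ≡ₙ⇒+* {n} i j (mk≡ (divides k eq)) j≤i = ℤ.∣ k ∣ , (begin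
    i                                    ≡⟨ ℕ.m+[n∸m]≡n j≤i ⟨
    j ℕ.+ (i ℕ.∸ j)                      ≡⟨ cong (j ℕ.+_) (cong ℤ.∣_∣ d) ⟩
    j ℕ.+ ℤ.∣ k ℤ.* 3^ n ∣               ≡⟨ cong (j ℕ.+_) (ℤ.abs-* k (3^ n)) ⟩
    j ℕ.+ ℤ.∣ k ∣ ℕ.* 3 ℕ.^ n            ∎)
    where
    open ≡-Reasoning
    d : + (i ℕ.∸ j) ≡ k ℤ.* 3^ n
    d = trans (sym (trans (ℤ.m-n≡m⊖n i j) (ℤ.⊖-≥ j≤i))) eq

  geomℤ-period : ∀ {a} n i j → a ≡ + 1 [3^ 1 ] → + i ≡ + j [3^ n ] →
                 geomℤ a i ≡ geomℤ a j [3^ n ]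
  geomℤ-period {a} n i j a≡1 e with ℕ.≤-total j i
  ... | inj₁ j≤i with ≡ₙ⇒+* i j e j≤i
  ...   | k , refl = geomℤ-period* n j k a≡1
  geomℤ-period {a} n i j a≡1 e | inj₂ i≤j with ≡ₙ⇒+* j i (≡ₙ-sym e) i≤j
  ...   | k , refl = ≡ₙ-sym (geomℤ-period* n i k a≡1)

------------------------------------------------------------------------

abstract

  U1⇒≡1 : ∀ {q} n → q ∈ U 1 → approx q (suc n) ≡ + 1 [3^ 1 ]
  U1⇒≡1 {q} n q∈U = ≡ₙ-trans (coherent-≤ q (ℕ.s≤s ℕ.z≤n)) (∈coset⇒≡ₙ {1} {1#} {q} q∈U)

  mod-1 : ∀ {a b} → a ≡ b [3^ 0 ]
  mod-1 {a} {b} = ≡ₙ-by (a ℤ.- b) (sym (ℤ.*-identityʳ (a ℤ.- b)))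

  geom-approx-period : ∀ {q} n m i j → q ∈ U 1 → n ℕ.≤ m → + i ≡ + j [3^ n ] →
                       geomℤ (approx q m) i ≡ geomℤ (approx q n) j [3^ n ]
  geom-approx-period zero m i j q∈U _ e = mod-1
  geom-approx-period {q} (suc n) m i j q∈U n≤m e =
    ≡ₙ-trans (geomℤ-cong i (coherent-≤ q n≤m)) (geomℤ-period (suc n) i j (U1⇒≡1 n q∈U) e)

-- The function ι_q for q ∈ U⁽¹⁾: modulo 3ⁿ it is 1 + q + ⋯ + qʳ⁻¹, where
-- r ∈ ℕ is the residue of z modulo 3ⁿ.  Lemmas ι-continuous, ι-fromℕ and
-- ι-unique characterise it as the unique continuous function with
-- ι_q(n) = 1 + q + ⋯ + qⁿ⁻¹ for all natural n.
ι : (q : ℤ₃) → q ∈ U 1 → ℤ₃ → ℤ₃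
ι q q∈U z = mkℤ₃ (λ n → geomℤ (approx q n) (approx z n mod3^ n)) λ n →
  geom-approx-period {q} n (suc n) _ _ q∈U (ℕ.n≤1+n n)
    (≡ₙ-trans (≡ₙ-weaken (ℕ.n≤1+n n) (mod3^-≡ₙ (suc n) (approx z (suc n))))
      (≡ₙ-trans (coherent z n) (≡ₙ-sym (mod3^-≡ₙ n (approx z n)))))

Continuous : Pred (ℤ₃ → ℤ₃) 0ℓ
Continuous f = ∀ z n → ∃ λ m → ∀ w → w ∈ z +⟨ 3 ℕ.^ m ⟩ → f w ∈ f z +⟨ 3 ℕ.^ n ⟩

abstract

  ι-ball : ∀ q q∈U z w n → approx w n ≡ approx z n [3^ n ] →
           approx (ι q q∈U w) n ≡ approx (ι q q∈U z) n [3^ n ]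
  ι-ball q q∈U z w n e = geom-approx-period {q} n n _ _ q∈U ℕ.≤-refl
    (≡ₙ-trans (mod3^-≡ₙ n (approx w n)) (≡ₙ-trans e (≡ₙ-sym (mod3^-≡ₙ n (approx z n)))))

  ι-continuous : ∀ q q∈U → Continuous (ι q q∈U)
  ι-continuous q q∈U z n = n , λ w w∈ →
    ≡ₙ⇒∈coset {n} {ι q q∈U z} {ι q q∈U w} (ι-ball q q∈U z w n (∈coset⇒≡ₙ {n} {z} {w} w∈))

  ι-fromℕ : ∀ q q∈U k → ι q q∈U (fromℕ k) ≈ geom q k
  ι-fromℕ q q∈U k = mk≈ λ n →
    ≡ₙ-trans (geom-approx-period {q} n n _ k q∈U ℕ.≤-refl (mod3^-≡ₙ n (+ k)))
      (≡ₙ-reflexive (sym (approx-geom q k n)))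

  ι-unique : ∀ q q∈U (f : ℤ₃ → ℤ₃) → Continuous f → (∀ k → f (fromℕ k) ≈ geom q k) →
             ∀ z → f z ≈ ι q q∈U z
  ι-unique q q∈U f f-cont f-geom z = mk≈ λ n → at n (f-cont z n)
    where
    at : ∀ n → (∃ λ m → ∀ w → w ∈ z +⟨ 3 ℕ.^ m ⟩ → f w ∈ f z +⟨ 3 ℕ.^ n ⟩) →
         approx (f z) n ≡ approx (ι q q∈U z) n [3^ n ]
    at n (m , close) =
      ≡ₙ-trans (≡ₙ-sym (∈coset⇒≡ₙ {n} {f z} {f w}
                 (close w (≡ₙ⇒∈coset {m} {z} {w} (w≡z m (ℕ.m≤m+n m n))))))
        (≡ₙ-trans (≈-at (f-geom k) n)
          (≡ₙ-trans (≡ₙ-sym (≈-at (ι-fromℕ q q∈U k) n))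
            (ι-ball q q∈U z w n (w≡z n (ℕ.m≤n+m n m)))))
      where
      k : ℕ
      k = approx z (m ℕ.+ n) mod3^ (m ℕ.+ n)
      w : ℤ₃
      w = fromℕ k
      w≡z : ∀ i → i ℕ.≤ m ℕ.+ n → + k ≡ approx z i [3^ i ]
      w≡z i i≤ = ≡ₙ-trans (≡ₙ-weaken i≤ (mod3^-≡ₙ (m ℕ.+ n) (approx z (m ℕ.+ n))))
                   (coherent-≤ z i≤)

NontrivialFixedPoint : (q : ℤ₃) → q ∈ U 1 → Pred ℤ₃ 0ℓ
NontrivialFixedPoint q q∈U z = ι q q∈U z ≈ z × ¬ z ≈ 0# × ¬ z ≈ 1#

-- ι q q∈U z modulo 3ⁿ does not depend on the proof q∈U, so it is harmless
-- that the membership proof is existentially quantified here.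
NoNontrivialFixedPoint : Pred ℤ₃ 0ℓ
NoNontrivialFixedPoint q = ∃ λ (q∈U : q ∈ U 1) → ¬ ∃ (NontrivialFixedPoint q q∈U)

{-# OPTIONS --safe #-}

-- Write q = 1 + 3u with u a unit.  Expanding q^z binomially gives
--   ι_q(z) - z = (3/2) u z (z - 1) G(u, z),   G(u, z) = 1 + u (z - 2) + 3 R(u, z),
-- where R is a convergent series of polynomials over ℤ₃ and hence preserves
-- congruences modulo 3ⁿ.  The nontrivial fixed points are therefore the roots
-- of G(u, ·) other than 0 and 1.  Since u is a unit, G(u, z) = 0 is equivalent
-- to an equation z = τ + 3 f(z) with f nonexpansive, which has exactly one
-- solution, and τ = 1 for q ≡ 4, τ = 0 for q ≡ 7 (mod 9).  This root is trivial
-- iff G(u, τ) = 0, which in turn is a fixed point equation u = c + 3 f(u) and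
-- so singles out one u in each residue class.

module Submission where

open import Defs
open import Algebra.Bundles using (CommutativeRing)
open import Data.Empty using (⊥-elim)
open import Data.Integer.Base as ℤ using (ℤ; +_)
import Data.Integer.Properties as ℤ
open import Data.Integer.Divisibility.Signed as ℤ∣ using (divides; _∣?_)
open import Data.Integer.DivMod using (n%ℕd<d)
open import Data.Integer.Tactic.RingSolver using (solve-∀)
open import Data.Nat.Base as ℕ using (ℕ; zero; suc; _!; s≤s; z≤n)
import Data.Nat.Properties as ℕ
open import Data.Nat.Tactic.RingSolver using () renaming (solve-∀ to ℕ-solve-∀)
import Data.Nat.Divisibility as ℕ∣
import Data.Nat.DivMod as ℕ
open import Data.Nat.Induction using (<-rec)
open import Data.Nat.Primality using (Prime; prime?; euclidsLemma)
open import Data.Product using (Σ; ∃; _×_; _,_; proj₁; proj₂; ∃!)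
open import Data.Sum using (_⊎_; inj₁; inj₂; map₁)
open import Relation.Binary.PropositionalEquality
  using (_≡_; refl; sym; trans; cong; subst; module ≡-Reasoning)
open import Relation.Nullary using (¬_; Dec; yes; no; contradiction)
open import Relation.Nullary.Decidable using (map′; from-yes)
open import Relation.Unary using (_∈_; _∖_)

open CommutativeRing ℤ₃-commutativeRing using (+-cong; *-cong; -‿cong)

-- Congruence of 3-adic integers modulo 3ⁿ

infix 4 _≈[_]_

-- A record rather than a synonym, so that `x` and `y` can be inferred; the integers `approx x n`
-- and `approx y n` alone do not determine them.
record _≈[_]_ (x : ℤ₃) (n : ℕ) (y : ℤ₃) : Set where
  constructor mk≈[]
  field at-level : approx x n ≡ approx y n [3^ n ]

open _≈[_]_

Nonexpansive : (ℤ₃ → ℤ₃) → Set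
Nonexpansive f = ∀ {n x y} → x ≈[ n ] y → f x ≈[ n ] f y

≈[]-refl : ∀ {n x} → x ≈[ n ] x
≈[]-refl = mk≈[] ≡ₙ-refl

≈[]-sym : ∀ {n x y} → x ≈[ n ] y → y ≈[ n ] x
≈[]-sym (mk≈[] e) = mk≈[] (≡ₙ-sym e)

≈[]-trans : ∀ {n x y z} → x ≈[ n ] y → y ≈[ n ] z → x ≈[ n ] z
≈[]-trans (mk≈[] e) (mk≈[] f) = mk≈[] (≡ₙ-trans e f)

≈⇒≈[] : ∀ {n x y} → x ≈ y → x ≈[ n ] y
≈⇒≈[] {n} (mk≈ e) = mk≈[] (e n)

≈[]⇒≈ : ∀ {x y} → (∀ n → x ≈[ n ] y) → x ≈ y
≈[]⇒≈ e = mk≈ λ n → at-level (e n)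

≈[0] : ∀ {x y} → x ≈[ 0 ] y
≈[0] = mk≈[] mod-1

+-cong[] : ∀ {n a b c d} → a ≈[ n ] b → c ≈[ n ] d → a + c ≈[ n ] b + d
+-cong[] (mk≈[] e) (mk≈[] f) = mk≈[] (≡ₙ-+-cong e f)

*-cong[] : ∀ {n a b c d} → a ≈[ n ] b → c ≈[ n ] d → a * c ≈[ n ] b * d
*-cong[] (mk≈[] e) (mk≈[] f) = mk≈[] (≡ₙ-*-cong e f)

-‿cong[] : ∀ {n a b} → a ≈[ n ] b → - a ≈[ n ] - b
-‿cong[] (mk≈[] e) = mk≈[] (≡ₙ-neg-cong e)

≈[]-weaken : ∀ {m n x y} → n ℕ.≤ m → x ≈[ m ] y → x ≈[ n ] y
≈[]-weaken {m} {n} {x} {y} n≤m (mk≈[] e) = mk≈[]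
  (≡ₙ-trans (≡ₙ-sym (coherent-≤ x n≤m)) (≡ₙ-trans (≡ₙ-weaken n≤m e) (coherent-≤ y n≤m)))

nonexpansive-cong : ∀ {f} → Nonexpansive f → ∀ {x y} → x ≈ y → f x ≈ f y
nonexpansive-cong f-ne x≈y = ≈[]⇒≈ λ n → f-ne (≈⇒≈[] x≈y)

-- The factor 3 supplies one further digit of agreement; this is what makes `c + 3 f(x)` a
-- contraction.
3*-gain : ∀ {n x y} → x ≈[ n ] y → fromℕ 3 * x ≈[ suc n ] fromℕ 3 * y
3*-gain {n} {x} {y} (mk≈[] e)
  -- The hypothesis concerns representatives at level `n`, the goal those at level `suc n`;
  -- coherence moves between the two.
  with ≡ₙ-trans (coherent x n) (≡ₙ-trans e (≡ₙ-sym (coherent y n)))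
... | mk≡ (divides k eq) = mk≈[] (≡ₙ-by k (begin
  + 3 ℤ.* X ℤ.- + 3 ℤ.* Y     ≡⟨ lem₁ X Y ⟩
  + 3 ℤ.* (X ℤ.- Y)           ≡⟨ cong (+ 3 ℤ.*_) eq ⟩
  + 3 ℤ.* (k ℤ.* 3^ n)        ≡⟨ lem₂ k (3^ n) ⟩
  k ℤ.* (+ 3 ℤ.* 3^ n)        ≡⟨ cong (k ℤ.*_) (ℤ.pos-* 3 (3 ℕ.^ n)) ⟨
  k ℤ.* 3^ (suc n)            ∎))
  where
  open ≡-Reasoning
  X Y : ℤ
  X = approx x (suc n)
  Y = approx y (suc n)
  lem₁ : ∀ a b → + 3 ℤ.* a ℤ.- + 3 ℤ.* b ≡ + 3 ℤ.* (a ℤ.- b)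
  lem₁ = solve-∀
  lem₂ : ∀ k P → + 3 ℤ.* (k ℤ.* P) ≡ k ℤ.* (+ 3 ℤ.* P)
  lem₂ = solve-∀

-- Identities in ℤ₃ are checked by the ring solver for ℤ on representatives.

infix 4 _≐_

_≐_ : ℤ₃ → ℤ₃ → Set
x ≐ y = ∀ n → approx x n ≡ approx y n

≐⇒≈ : ∀ {x y} → x ≐ y → x ≈ y
≐⇒≈ e = mk≈ λ n → ≡ₙ-reflexive (e n)

difference≈0 : ∀ {x y} → x ≈ y → x + - y ≈ 0#
difference≈0 {x} {y} e = ≈-trans (+-cong e (≈-refl { - y})) (≐⇒≈ λ n → ℤ.+-inverseʳ (approx y n))

difference≈0⁻¹ : ∀ {x y} → x + - y ≈ 0# → x ≈ y
difference≈0⁻¹ {x} {y} e =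
  ≈-trans (≐⇒≈ λ n → lem (approx x n) (approx y n))
    (≈-trans (+-cong e (≈-refl {y})) (≐⇒≈ λ n → ℤ.+-identityˡ (approx y n)))
  where
  lem : ∀ x y → x ≡ (x ℤ.- y) ℤ.+ y
  lem = solve-∀

*-vanish : ∀ k {x} → x ≈ 0# → k * x ≈ 0#
*-vanish k e = ≈-trans (*-cong (≈-refl {k}) e) (≐⇒≈ λ n → ℤ.*-zeroʳ (approx k n))

-- Reduces an equation to a polynomial identity expressing the difference of its sides through the
-- difference of a known equation, which the solver can check over ℤ.
linear-combination : ∀ {x y a b} → a ≈ b → ∀ k → x + - y ≐ k * (a + - b) → x ≈ y
linear-combination e k eq = difference≈0⁻¹ (≈-trans (≐⇒≈ eq) (*-vanish k (difference≈0 e)))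

linear-combination₂ : ∀ {x y a b c d} → a ≈ b → c ≈ d → ∀ k l →
                      x + - y ≐ k * (a + - b) + l * (c + - d) → x ≈ y
linear-combination₂ {a = a} {b} {c} {d} e f k l eq =
  linear-combination (+-cong (*-vanish k (difference≈0 e)) (*-vanish l (difference≈0 f))) 1#
    λ n → trans (eq n) (lem (approx (k * (a + - b)) n) (approx (l * (c + - d)) n))
  where
  lem : ∀ s t → s ℤ.+ t ≡ + 1 ℤ.* ((s ℤ.+ t) ℤ.- (+ 0 ℤ.+ + 0))
  lem = solve-∀

-- ℤ₃ is an integral domain

prime-3 : Prime 3
prime-3 = from-yes (prime? 3)

-- Euclid's lemma finds a factor 3 in `a` or in `b`; removing it lowers `n` or `m` respectively.
3^-∣-* : ∀ n m a b → 3 ℕ.^ (n ℕ.+ m) ℕ∣.∣ a ℕ.* b → 3 ℕ.^ n ℕ∣.∣ a ⊎ 3 ℕ.^ m ℕ∣.∣ b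
3^-∣-* zero    m       a b d = inj₁ (ℕ∣.1∣ a)
3^-∣-* (suc n) zero    a b d = inj₂ (ℕ∣.1∣ b)
3^-∣-* (suc n) (suc m) a b d
  with euclidsLemma a b prime-3 (ℕ∣.∣-trans (ℕ∣.m∣m*n (3 ℕ.^ (n ℕ.+ suc m))) d)
... | inj₁ (ℕ∣.divides a′ refl) =
  map₁ (λ e → subst (3 ℕ.^ suc n ℕ∣.∣_) (ℕ.*-comm 3 a′) (ℕ∣.*-monoʳ-∣ 3 e))
    (3^-∣-* n (suc m) a′ b (ℕ∣.*-cancelˡ-∣ 3 (subst (3 ℕ.^ (suc n ℕ.+ suc m) ℕ∣.∣_) eq d)))
  where
  eq : a′ ℕ.* 3 ℕ.* b ≡ 3 ℕ.* (a′ ℕ.* b)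
  eq = trans (cong (ℕ._* b) (ℕ.*-comm a′ 3)) (ℕ.*-assoc 3 a′ b)
... | inj₂ (ℕ∣.divides b′ refl)
  with 3^-∣-* (suc n) m a b′ (ℕ∣.*-cancelˡ-∣ 3
         (subst (ℕ∣._∣ 3 ℕ.* (a ℕ.* b′)) (cong (3 ℕ.^_) (ℕ.+-suc (suc n) m))
           (subst (3 ℕ.^ (suc n ℕ.+ suc m) ℕ∣.∣_) eq d)))
  where
  eq : a ℕ.* (b′ ℕ.* 3) ≡ 3 ℕ.* (a ℕ.* b′)
  eq = trans (sym (ℕ.*-assoc a b′ 3)) (ℕ.*-comm (a ℕ.* b′) 3)
...   | inj₁ e = inj₁ e
...   | inj₂ e = inj₂ (subst (3 ℕ.^ suc m ℕ∣.∣_) (ℕ.*-comm 3 b′) (ℕ∣.*-monoʳ-∣ 3 e))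

≈[]-dec : ∀ n x y → Dec (x ≈[ n ] y)
≈[]-dec n x y = map′ (λ d → mk≈[] (mk≡ d)) (λ (mk≈[] (mk≡ d)) → d) (_ ∣? _)

-- Equality in ℤ₃ is a conjunction of decidable congruences, so equations may be proved by
-- contradiction.
≈-stable : ∀ {x y} → ¬ ¬ x ≈ y → x ≈ y
≈-stable {x} {y} ¬¬e = ≈[]⇒≈ λ n → go n (≈[]-dec n x y)
  where
  go : ∀ n → Dec (x ≈[ n ] y) → x ≈[ n ] y
  go n (yes e) = e
  go n (no ¬e) = ⊥-elim (¬¬e λ e → ¬e (≈⇒≈[] e))

≈[]0⇒∣ : ∀ {n x} → x ≈[ n ] 0# → 3 ℕ.^ n ℕ∣.∣ ℤ.∣ approx x n ∣
≈[]0⇒∣ {n} {x} (mk≈[] (mk≡ d)) =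
  subst (λ i → 3 ℕ.^ n ℕ∣.∣ ℤ.∣ i ∣) (ℤ.+-identityʳ (approx x n)) (ℤ∣.∣⇒∣ᵤ d)

∣⇒≈[]0 : ∀ {n m x} → n ℕ.≤ m → 3 ℕ.^ n ℕ∣.∣ ℤ.∣ approx x m ∣ → x ≈[ n ] 0#
∣⇒≈[]0 {n} {m} {x} n≤m d = mk≈[] (≡ₙ-trans (≡ₙ-sym (coherent-≤ x n≤m))
  (mk≡ (ℤ∣.∣ᵤ⇒∣ (subst (λ i → 3 ℕ.^ n ℕ∣.∣ ℤ.∣ i ∣) (sym (ℤ.+-identityʳ (approx x m))) d))))

x*y≈[]0 : ∀ n m {x y} → x * y ≈[ n ℕ.+ m ] 0# → x ≈[ n ] 0# ⊎ y ≈[ m ] 0#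
x*y≈[]0 n m {x} {y} e
  with 3^-∣-* n m ℤ.∣ approx x (n ℕ.+ m) ∣ ℤ.∣ approx y (n ℕ.+ m) ∣
         (subst (3 ℕ.^ (n ℕ.+ m) ℕ∣.∣_) (ℤ.abs-* (approx x (n ℕ.+ m)) (approx y (n ℕ.+ m))) (≈[]0⇒∣ e))
... | inj₁ d = inj₁ (∣⇒≈[]0 (ℕ.m≤m+n n m) d)
... | inj₂ d = inj₂ (∣⇒≈[]0 (ℕ.m≤n+m m n) d)

-- If `x` were nonzero modulo some 3ⁿ, then `x*y≈[]0` would make `y` vanish modulo every 3ᵐ. Thus
-- `y` nonzero forces `x` to vanish at every level.
x*y≈0⇒y≈0 : ∀ {x y} → ¬ x ≈ 0# → x * y ≈ 0# → y ≈ 0#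
x*y≈0⇒y≈0 {x} {y} x≉0 e = ≈-stable λ y≉0 → x≉0 (≈[]⇒≈ λ n → ≈-at-n n y≉0)
  where
  ≈-at-n : ∀ n → ¬ y ≈ 0# → x ≈[ n ] 0#
  ≈-at-n n y≉0 with ≈[]-dec n x 0#
  ... | yes x≈0 = x≈0
  ... | no  x≉0 = ⊥-elim (y≉0 (≈[]⇒≈ λ m → go m (x*y≈[]0 n m (≈⇒≈[] e))))
    where
    go : ∀ m → x ≈[ n ] 0# ⊎ y ≈[ m ] 0# → y ≈[ m ] 0#
    go m (inj₁ x≈0) = contradiction x≈0 x≉0
    go m (inj₂ y≈0) = y≈0

*-cancelˡ-≈ : ∀ {x y z} → ¬ x ≈ 0# → x * y ≈ x * z → y ≈ z
*-cancelˡ-≈ {x} {y} {z} x≉0 e = difference≈0⁻¹ (x*y≈0⇒y≈0 x≉0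
  (linear-combination e 1# λ n → lem (approx x n) (approx y n) (approx z n)))
  where
  lem : ∀ x y z → x ℤ.* (y ℤ.- z) ℤ.- + 0 ≡ + 1 ℤ.* (x ℤ.* y ℤ.- x ℤ.* z)
  lem = solve-∀

n<3^n : ∀ n → n ℕ.< 3 ℕ.^ n
n<3^n zero    = s≤s z≤n
n<3^n (suc n) = ℕ.≤-trans (ℕ.+-mono-≤ (ℕ.m^n>0 3 n) (n<3^n n))
                  (ℕ.+-monoʳ-≤ (3 ℕ.^ n) (ℕ.m≤m+n (3 ℕ.^ n) _))

-- Level `n` already suffices, since `n < 3ⁿ` excludes divisibility of a positive `n` by 3ⁿ.
fromℕ≉0 : ∀ n .{{_ : ℕ.NonZero n}} → ¬ fromℕ n ≈ 0#
fromℕ≉0 n e = ℕ.<⇒≱ (n<3^n n) (ℕ∣.∣⇒≤ (≈[]0⇒∣ {n} {fromℕ n} (≈⇒≈[] e)))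

1+3x≉0 : ∀ x → ¬ 1# + fromℕ 3 * x ≈ 0#
1+3x≉0 x e with ≈[]-trans (≈[]-sym (≈⇒≈[] {1} e))
                  (+-cong[] (≈[]-refl {x = 1#}) (3*-gain (≈[0] {x} {0#})))
... | mk≈[] (mk≡ d) = ℕ∣.>⇒∤ (s≤s (s≤s z≤n)) (ℤ∣.∣⇒∣ᵤ d)

-- Limits and contractions

-- The diagonal sequence: digits up to level `n` are read off the `n`-th term, after which they no
-- longer change.
lim : (s : ℕ → ℤ₃) → (∀ n → s (suc n) ≈[ n ] s n) → ℤ₃
lim s s-cauchy = mkℤ₃ (λ n → approx (s n) n) λ n →
  ≡ₙ-trans (coherent (s (suc n)) n) (at-level (s-cauchy n))

lim≈[] : ∀ {s} s-cauchy n → lim s s-cauchy ≈[ n ] s n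
lim≈[] s-cauchy n = mk≈[] ≡ₙ-refl

module Contraction (c : ℤ₃) {f : ℤ₃ → ℤ₃} (f-ne : Nonexpansive f) where

  step : ℤ₃ → ℤ₃
  step x = c + fromℕ 3 * f x

  step-gain : ∀ {n x y} → x ≈[ n ] y → step x ≈[ suc n ] step y
  step-gain e = +-cong[] ≈[]-refl (3*-gain (f-ne e))

  iterate : ℕ → ℤ₃
  iterate zero    = c
  iterate (suc n) = step (iterate n)

  iterate-cauchy : ∀ n → iterate (suc n) ≈[ n ] iterate n
  iterate-cauchy zero    = ≈[0]
  iterate-cauchy (suc n) = step-gain (iterate-cauchy n)

  abstract

    fixed-point : ∃ λ x → x ≈ step x
    fixed-point = x , ≈[]⇒≈ λ n →
      -- Modulo 3ⁿ the limit agrees with `iterate n`, hence with `step (iterate n)`, hence with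
      -- `step` of the limit.
      ≈[]-trans (lim≈[] iterate-cauchy n)
        (≈[]-trans (≈[]-sym (iterate-cauchy n))
          (≈[]-weaken (ℕ.n≤1+n n) (step-gain (≈[]-sym (lim≈[] iterate-cauchy n)))))
      where
      x : ℤ₃
      x = lim iterate iterate-cauchy

  fixed-point-unique : ∀ {x y} → x ≈ step x → y ≈ step y → x ≈ y
  fixed-point-unique {x} {y} x≈ y≈ = ≈[]⇒≈ go
    where
    go : ∀ n → x ≈[ n ] y
    go zero    = ≈[0]
    go (suc n) = ≈[]-trans (≈⇒≈[] x≈) (≈[]-trans (step-gain (go n)) (≈⇒≈[] (≈-sym y≈)))

-- The 3-adic valuation of factorials

fromℕ-* : ∀ m n → fromℕ (m ℕ.* n) ≈ fromℕ m * fromℕ n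
fromℕ-* m n = ≐⇒≈ λ _ → ℤ.pos-* m n

fromℕ-3^-+ : ∀ m n → fromℕ (3 ℕ.^ (m ℕ.+ n)) ≈ fromℕ (3 ℕ.^ m) * fromℕ (3 ℕ.^ n)
fromℕ-3^-+ m n = ≐⇒≈ λ _ → 3^-+ m n

-- The inverse `y` of `1 + 3x` is the fixed point of `y = 1 + 3 (- x y)`.
inverse : ∀ x → ∃ λ y → (1# + fromℕ 3 * x) * y ≈ 1#
inverse x with Contraction.fixed-point 1# {λ y → - (x * y)} (λ e → -‿cong[] (*-cong[] ≈[]-refl e))
... | y , y≈ = y , linear-combination y≈ 1# λ n → lem (approx x n) (approx y n)
  where
  lem : ∀ x y → (+ 1 ℤ.+ + 3 ℤ.* x) ℤ.* y ℤ.- + 1 ≡ + 1 ℤ.* (y ℤ.- (+ 1 ℤ.+ + 3 ℤ.* (ℤ.- (x ℤ.* y))))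
  lem = solve-∀

inverse-1+m*3 : ∀ m → ∃ λ y → fromℕ (1 ℕ.+ m ℕ.* 3) * y ≈ 1#
inverse-1+m*3 m with inverse (fromℕ m)
... | y , y≈ = y , linear-combination₂ y≈ (fromℕ-* m 3) 1# y λ n → lem (approx y n) (+ m) (+ (m ℕ.* 3))
  where
  lem : ∀ y m p → (+ 1 ℤ.+ p) ℤ.* y ℤ.- + 1 ≡
        + 1 ℤ.* ((+ 1 ℤ.+ + 3 ℤ.* m) ℤ.* y ℤ.- + 1) ℤ.+ y ℤ.* (p ℤ.- m ℤ.* + 3)
  lem = solve-∀

inverse-2+m*3 : ∀ m → ∃ λ y → fromℕ (2 ℕ.+ m ℕ.* 3) * y ≈ 1#
inverse-2+m*3 m with inverse (- (1# + fromℕ m))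
-- `2 + 3m` is the negative of `1 + 3 (- (1 + m))`.
... | y , y≈ = - y , linear-combination₂ y≈ (fromℕ-* m 3) 1# (- y)
                       λ n → lem (approx y n) (+ m) (+ (m ℕ.* 3))
  where
  lem : ∀ y m p → (+ 2 ℤ.+ p) ℤ.* (ℤ.- y) ℤ.- + 1 ≡
        + 1 ℤ.* ((+ 1 ℤ.+ + 3 ℤ.* (ℤ.- (+ 1 ℤ.+ m))) ℤ.* y ℤ.- + 1) ℤ.+ (ℤ.- y) ℤ.* (p ℤ.- m ℤ.* + 3)
  lem = solve-∀

!*-step : ∀ n {b} k → fromℕ (n !) * b ≈ fromℕ k → fromℕ (suc n !) * b ≈ fromℕ (suc n ℕ.* k)
!*-step n {b} k e = ≈-trans
  (linear-combination₂ (fromℕ-* (suc n) (n !)) e b (fromℕ (suc n))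
    λ i → lem (+ (suc n !)) (+ (suc n)) (+ (n !)) (+ k) (approx b i))
  (≈-sym (fromℕ-* (suc n) k))
  where
  lem : ∀ a s f k b → a ℤ.* b ℤ.- s ℤ.* k ≡ b ℤ.* (a ℤ.- s ℤ.* f) ℤ.+ s ℤ.* (f ℤ.* b ℤ.- k)
  lem = solve-∀

-- A new factor that is a unit is absorbed by its inverse `y`, leaving the right-hand side
-- unchanged.
!*-unit-step : ∀ n {b y} k → fromℕ (suc n) * y ≈ 1# → fromℕ (n !) * b ≈ fromℕ k →
               fromℕ (suc n !) * (y * b) ≈ fromℕ k
!*-unit-step n {b} {y} k u e =
  linear-combination₂ (≈-trans (!*-step n k e) (fromℕ-* (suc n) k)) u y (fromℕ k)
    λ i → lem (+ (suc n !)) (+ (suc n)) (+ k) (approx b i) (approx y i)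
  where
  lem : ∀ a s k b y → a ℤ.* (y ℤ.* b) ℤ.- k ≡
        y ℤ.* (a ℤ.* b ℤ.- s ℤ.* k) ℤ.+ k ℤ.* (s ℤ.* y ℤ.- + 1)
  lem = solve-∀

-- Among 1, …, r + 3m (r < 3) the multiples of 3 are 3·1, …, 3·m, so the
-- quotient of (r + 3m)! by 3ᵐ m! is a unit.
!-block : ∀ r m → r ℕ.< 3 → ∃ λ b → fromℕ ((r ℕ.+ m ℕ.* 3) !) * b ≈ fromℕ (3 ℕ.^ m ℕ.* m !)
!-block 0 zero    _ = 1# , ≐⇒≈ λ _ → refl
!-block 0 (suc m) _ with !-block 2 m (s≤s (s≤s (s≤s z≤n)))
-- The new factor `3 + 3m = 3 (m + 1)` turns `3ᵐ m!` into `3ᵐ⁺¹ (m + 1)!`.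
... | b , e = b , ≈-trans (!*-step (2 ℕ.+ m ℕ.* 3) (3 ℕ.^ m ℕ.* m !) e)
                          (≐⇒≈ λ _ → cong +_ (lem m (3 ℕ.^ m) (m !)))
  where
  lem : ∀ m p f → (3 ℕ.+ m ℕ.* 3) ℕ.* (p ℕ.* f) ≡ 3 ℕ.* p ℕ.* (suc m ℕ.* f)
  lem = ℕ-solve-∀
!-block 1 m _ =
  let (b , e) = !-block 0 m (s≤s z≤n)
      (y , u) = inverse-1+m*3 m
  in y * b , !*-unit-step (m ℕ.* 3) (3 ℕ.^ m ℕ.* m !) u e
!-block 2 m _ =
  let (b , e) = !-block 1 m (s≤s (s≤s z≤n))
      (y , u) = inverse-2+m*3 m
  in y * b , !*-unit-step (1 ℕ.+ m ℕ.* 3) (3 ℕ.^ m ℕ.* m !) u e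
!-block (suc (suc (suc r))) m (s≤s (s≤s (s≤s ())))

-- The divisibility k! ∣ 3ᵉ in ℤ₃ says that v₃(k!) ≤ e.
!-Bound : ℕ → Set
!-Bound k = ∃ λ e → 2 ℕ.* e ℕ.< k × ∃ λ b → fromℕ (k !) * b ≈ fromℕ (3 ℕ.^ e)

-- Legendre's recursion: for `k = r + 3m` one has v₃(k!) = m + v₃(m!), so `2 v₃(m!) < m` gives
-- `2 v₃(k!) < 3m ≤ k`. The bound fails at 0, so `m = 0` is treated apart.
!-bound-block : ∀ r m → r ℕ.< 3 → 0 ℕ.< r ℕ.+ m ℕ.* 3 → (0 ℕ.< m → !-Bound m) → !-Bound (r ℕ.+ m ℕ.* 3)
!-bound-block r zero r<3 0<k _ with !-block r 0 r<3
... | b , e = 0 , 0<k , b , e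
!-bound-block r m@(suc _) r<3 0<k rec with !-block r m r<3 | rec (s≤s z≤n)
... | b , eb | e , 2e<m , c , ec = m ℕ.+ e , bound , b * c , product
  where
  lem₁ : ∀ m e → suc (2 ℕ.* (m ℕ.+ e)) ≡ m ℕ.* 2 ℕ.+ suc (2 ℕ.* e)
  lem₁ = ℕ-solve-∀
  lem₂ : ∀ m → m ℕ.* 2 ℕ.+ m ≡ m ℕ.* 3
  lem₂ = ℕ-solve-∀
  bound : 2 ℕ.* (m ℕ.+ e) ℕ.< r ℕ.+ m ℕ.* 3
  bound = begin
    suc (2 ℕ.* (m ℕ.+ e))        ≡⟨ lem₁ m e ⟩
    m ℕ.* 2 ℕ.+ suc (2 ℕ.* e)    ≤⟨ ℕ.+-monoʳ-≤ (m ℕ.* 2) 2e<m ⟩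
    m ℕ.* 2 ℕ.+ m                ≡⟨ lem₂ m ⟩
    m ℕ.* 3                      ≤⟨ ℕ.m≤n+m (m ℕ.* 3) r ⟩
    r ℕ.+ m ℕ.* 3                ∎
    where open ℕ.≤-Reasoning
  lem₃ : ∀ k b c p f q → k ℤ.* (b ℤ.* c) ℤ.- p ℤ.* q ≡
         c ℤ.* (k ℤ.* b ℤ.- p ℤ.* f) ℤ.+ p ℤ.* (f ℤ.* c ℤ.- q)
  lem₃ = solve-∀
  product : fromℕ ((r ℕ.+ m ℕ.* 3) !) * (b * c) ≈ fromℕ (3 ℕ.^ (m ℕ.+ e))
  product = ≈-trans
    (linear-combination₂ (≈-trans eb (fromℕ-* (3 ℕ.^ m) (m !))) ec c (fromℕ (3 ℕ.^ m))
      λ n → lem₃ (+ ((r ℕ.+ m ℕ.* 3) !)) (approx b n) (approx c n) (3^ m) (+ (m !)) (3^ e))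
    (≈-sym (fromℕ-3^-+ m e))

!-bound : ∀ k → 0 ℕ.< k → !-Bound k
!-bound = <-rec (λ k → 0 ℕ.< k → !-Bound k) λ k rec 0<k →
  subst !-Bound (sym (ℕ.m≡m%n+[m/n]*n k 3))
    (!-bound-block (k ℕ.% 3) (k ℕ./ 3) (ℕ.m%n<n k 3)
      (subst (0 ℕ.<_) (ℕ.m≡m%n+[m/n]*n k 3) 0<k)
      (rec (ℕ.m/n<m k 3 {{ℕ.>-nonZero 0<k}} (s≤s (s≤s z≤n)))))

fromℕ-3^≈[]0 : ∀ {n m} → n ℕ.≤ m → fromℕ (3 ℕ.^ m) ≈[ n ] 0#
fromℕ-3^≈[]0 {n} {m} n≤m = ∣⇒≈[]0 {n} {n} {fromℕ (3 ℕ.^ m)} ℕ.≤-refl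
  (ℕ∣.divides (3 ℕ.^ (m ℕ.∸ n))
    (trans (cong (3 ℕ.^_) (sym (ℕ.m∸n+n≡m n≤m))) (ℕ.^-distribˡ-+-* 3 (m ℕ.∸ n) n)))

-- The coefficients of the series and their decay

abstract

  -- coefficient j = 2 · 3ʲ⁺¹ / (j+4)!
  coefficient : ℕ → ℤ₃
  coefficient j with !-bound (4 ℕ.+ j) (s≤s z≤n)
  ... | e , _ , b , _ = fromℕ (3 ℕ.^ (1 ℕ.+ j ℕ.∸ e)) * (fromℕ 2 * b)

  coefficient-*-! : ∀ j → fromℕ ((4 ℕ.+ j) !) * coefficient j ≈ fromℕ 2 * fromℕ (3 ℕ.^ (1 ℕ.+ j))
  coefficient-*-! j with !-bound (4 ℕ.+ j) (s≤s z≤n)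
  ... | e , 2e<4+j , b , eq =
    linear-combination₂ eq 3^-split (fromℕ (3 ℕ.^ (1 ℕ.+ j ℕ.∸ e)) * fromℕ 2) (fromℕ 2)
      λ n → lem (+ ((4 ℕ.+ j) !)) (3^ (1 ℕ.+ j ℕ.∸ e)) (approx b n) (3^ e) (3^ (1 ℕ.+ j))
    where
    -- This makes the truncated subtraction in `coefficient` exact.
    e≤1+j : e ℕ.≤ 1 ℕ.+ j
    e≤1+j = ℕ.≮⇒≥ λ 1+j<e → ℕ.<⇒≱ 2e<4+j (begin
      4 ℕ.+ j              ≤⟨ ℕ.+-monoʳ-≤ 4 (ℕ.m≤n*m j 2) ⟩
      4 ℕ.+ 2 ℕ.* j        ≡⟨ ℕ.*-distribˡ-+ 2 2 j ⟨
      2 ℕ.* (2 ℕ.+ j)      ≤⟨ ℕ.*-monoʳ-≤ 2 1+j<e ⟩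
      2 ℕ.* e              ∎)
      where open ℕ.≤-Reasoning
    3^-split : fromℕ (3 ℕ.^ (1 ℕ.+ j ℕ.∸ e)) * fromℕ (3 ℕ.^ e) ≈ fromℕ (3 ℕ.^ (1 ℕ.+ j))
    3^-split = ≈-sym (subst (λ i → fromℕ (3 ℕ.^ i) ≈ fromℕ (3 ℕ.^ (1 ℕ.+ j ℕ.∸ e)) * fromℕ (3 ℕ.^ e))
                            (ℕ.m∸n+n≡m e≤1+j) (fromℕ-3^-+ (1 ℕ.+ j ℕ.∸ e) e))
    lem : ∀ k p b q r → k ℤ.* (p ℤ.* (+ 2 ℤ.* b)) ℤ.- + 2 ℤ.* r ≡
          p ℤ.* + 2 ℤ.* (k ℤ.* b ℤ.- q) ℤ.+ + 2 ℤ.* (p ℤ.* q ℤ.- r)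
    lem = solve-∀

  -- The exponent `1 + j - e` grows like j/2 because `2e < 4 + j`. Hence modulo 3ⁿ the series can be
  -- cut after `n * 2` terms.
  coefficient-null : ∀ {n j} → n ℕ.* 2 ℕ.≤ j → coefficient j ≈[ n ] 0#
  coefficient-null {n} {j} n*2≤j with !-bound (4 ℕ.+ j) (s≤s z≤n)
  ... | e , 2e<4+j , b , eq =
    ≈[]-trans (*-cong[] (fromℕ-3^≈[]0 n≤) (≈[]-refl {x = fromℕ 2 * b})) (≈⇒≈[] (≐⇒≈ λ n → ℤ.*-zeroˡ (approx (fromℕ 2 * b) n)))
    where
    lem : ∀ n e → 2 ℕ.* (n ℕ.+ e) ≡ n ℕ.* 2 ℕ.+ 2 ℕ.* e
    lem = ℕ-solve-∀
    lem′ : ∀ j → 2 ℕ.* (2 ℕ.+ j) ≡ j ℕ.+ (4 ℕ.+ j)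
    lem′ = ℕ-solve-∀
    n+e≤1+j : n ℕ.+ e ℕ.≤ 1 ℕ.+ j
    n+e≤1+j = ℕ.≮⇒≥ λ 1+j<n+e → ℕ.<-irrefl refl (begin-strict
      2 ℕ.* (n ℕ.+ e)          ≡⟨ lem n e ⟩
      n ℕ.* 2 ℕ.+ 2 ℕ.* e      <⟨ ℕ.+-mono-≤-< n*2≤j 2e<4+j ⟩
      j ℕ.+ (4 ℕ.+ j)          ≡⟨ lem′ j ⟨
      2 ℕ.* (2 ℕ.+ j)          ≤⟨ ℕ.*-monoʳ-≤ 2 1+j<n+e ⟩
      2 ℕ.* (n ℕ.+ e)          ∎)
      where open ℕ.≤-Reasoning
    n≤ : n ℕ.≤ 1 ℕ.+ j ℕ.∸ e
    n≤ = ℕ.m+n≤o⇒m≤o∸n n n+e≤1+j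

coefficient-zero : fromℕ 4 * coefficient 0 ≈ 1#
coefficient-zero = *-cancelˡ-≈ (fromℕ≉0 6)
  (linear-combination (coefficient-*-! 0) 1# λ n → lem (approx (coefficient 0) n))
  where
  lem : ∀ r → + 6 ℤ.* (+ 4 ℤ.* r) ℤ.- + 6 ℤ.* + 1 ≡ + 1 ℤ.* (+ 24 ℤ.* r ℤ.- + 6)
  lem = solve-∀

-- Consecutive coefficients have ratio 3 / (j + 5); the common factor `(4 + j)!` is cancelled.
coefficient-suc : ∀ j → (fromℕ 5 + fromℕ j) * coefficient (suc j) ≈ fromℕ 3 * coefficient j
coefficient-suc j = *-cancelˡ-≈ (fromℕ≉0 ((4 ℕ.+ j) !) {{(4 ℕ.+ j) ℕ.!≢0}})
  (linear-combination₂ e₁ (coefficient-*-! j) 1# (- fromℕ 3)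
    λ n → lem (+ ((4 ℕ.+ j) !)) (+ j) (approx (coefficient (suc j)) n) (approx (coefficient j) n) (3^ (1 ℕ.+ j)))
  where
  e₁ : fromℕ (5 ℕ.+ j) * fromℕ ((4 ℕ.+ j) !) * coefficient (suc j) ≈
       fromℕ 2 * (fromℕ 3 * fromℕ (3 ℕ.^ (1 ℕ.+ j)))
  e₁ = ≈-trans (*-cong (≈-sym (fromℕ-* (5 ℕ.+ j) ((4 ℕ.+ j) !))) (≈-refl {coefficient (suc j)}))
    (≈-trans (coefficient-*-! (suc j)) (*-cong (≈-refl {fromℕ 2}) (fromℕ-* 3 (3 ℕ.^ (1 ℕ.+ j)))))
  lem : ∀ f j r r′ p → f ℤ.* ((+ 5 ℤ.+ j) ℤ.* r) ℤ.- f ℤ.* (+ 3 ℤ.* r′) ≡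
        + 1 ℤ.* ((+ 5 ℤ.+ j) ℤ.* f ℤ.* r ℤ.- + 2 ℤ.* (+ 3 ℤ.* p))
        ℤ.+ (ℤ.- + 3) ℤ.* (f ℤ.* r′ ℤ.- + 2 ℤ.* p)
  lem = solve-∀

-- The function G

-- G(u, z) is the sum of (2 · 3ᵏ⁻² / k!) uᵏ⁻² (z - 2) ⋯ (z - k + 1) over k ≥ 2.  The terms
-- k = 2, 3 are 1 and u (z - 2); the term k = j + 4 is 3 · coefficient j · monomial j.

monomial : ℕ → ℤ₃ → ℤ₃ → ℤ₃
monomial zero    u z = u * u * ((z + - fromℕ 2) * (z + - fromℕ 3))
monomial (suc j) u z = monomial j u z * (u * (z + - (fromℕ 4 + fromℕ j)))

partialSum : ℕ → ℤ₃ → ℤ₃ → ℤ₃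
partialSum zero    u z = 0#
partialSum (suc k) u z = partialSum k u z + coefficient k * monomial k u z

monomial-cong[] : ∀ j {n u v z w} → u ≈[ n ] v → z ≈[ n ] w → monomial j u z ≈[ n ] monomial j v w
monomial-cong[] zero    e f =
  *-cong[] (*-cong[] e e) (*-cong[] (+-cong[] f ≈[]-refl) (+-cong[] f ≈[]-refl))
monomial-cong[] (suc j) e f =
  *-cong[] (monomial-cong[] j e f) (*-cong[] e (+-cong[] f ≈[]-refl))

partialSum-cong[] : ∀ k {n u v z w} → u ≈[ n ] v → z ≈[ n ] w → partialSum k u z ≈[ n ] partialSum k v w
partialSum-cong[] zero    e f = ≈[]-refl
partialSum-cong[] (suc k) e f =
  +-cong[] (partialSum-cong[] k e f) (*-cong[] ≈[]-refl (monomial-cong[] k e f))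

partialSum-stable : ∀ n d u z → partialSum (d ℕ.+ n ℕ.* 2) u z ≈[ n ] partialSum (n ℕ.* 2) u z
partialSum-stable n zero    u z = ≈[]-refl
partialSum-stable n (suc d) u z = ≈[]-trans (+-cong[] (partialSum-stable n d u z) term≈0)
  (≈⇒≈[] (≐⇒≈ λ i → ℤ.+-identityʳ (approx (partialSum (n ℕ.* 2) u z) i)))
  where
  k : ℕ
  k = d ℕ.+ n ℕ.* 2
  term≈0 : coefficient k * monomial k u z ≈[ n ] 0#
  term≈0 = ≈[]-trans (*-cong[] (coefficient-null (ℕ.m≤n+m (n ℕ.* 2) d)) (≈[]-refl {x = monomial k u z}))
    (≈⇒≈[] (≐⇒≈ λ i → ℤ.*-zeroˡ (approx (monomial k u z) i)))

abstract

  -- The first `n * 2` terms determine the value modulo 3ⁿ, which fixes the rate needed by `lim`.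
  remainder : ℤ₃ → ℤ₃ → ℤ₃
  remainder u z = lim (λ n → partialSum (n ℕ.* 2) u z) (λ n → partialSum-stable n 2 u z)

  remainder-partialSum : ∀ n d u z → remainder u z ≈[ n ] partialSum (d ℕ.+ n ℕ.* 2) u z
  remainder-partialSum n d u z =
    ≈[]-trans (lim≈[] (λ n → partialSum-stable n 2 u z) n) (≈[]-sym (partialSum-stable n d u z))

remainder-cong[] : ∀ {n u v z w} → u ≈[ n ] v → z ≈[ n ] w → remainder u z ≈[ n ] remainder v w
remainder-cong[] {n} {u} {v} {z} {w} e f = ≈[]-trans (remainder-partialSum n 0 u z)
  (≈[]-trans (partialSum-cong[] (n ℕ.* 2) e f) (≈[]-sym (remainder-partialSum n 0 v w)))

withRemainder : ℤ₃ → ℤ₃ → ℤ₃ → ℤ₃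
withRemainder u z p = 1# + u * (z + - fromℕ 2) + fromℕ 3 * p

G : ℤ₃ → ℤ₃ → ℤ₃
G u z = withRemainder u z (remainder u z)

G-cong : ∀ {u v z w} → u ≈ v → z ≈ w → G u z ≈ G v w
G-cong e f = ≈[]⇒≈ λ n → +-cong[]
  (+-cong[] (≈[]-refl {x = 1#}) (*-cong[] (≈⇒≈[] e) (+-cong[] (≈⇒≈[] f) (≈[]-refl {x = - fromℕ 2}))))
  (*-cong[] (≈[]-refl {x = fromℕ 3}) (remainder-cong[] (≈⇒≈[] e) (≈⇒≈[] f)))

-- The recurrence under z ↦ z + 1

T : ℤ₃ → ℤ₃ → ℤ₃ → ℤ₃
T u z p = z * ((z + - 1#) * withRemainder u z p)

T-cong[] : ∀ {n u v z w p q} → u ≈[ n ] v → z ≈[ n ] w → p ≈[ n ] q → T u z p ≈[ n ] T v w q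
T-cong[] e f g = *-cong[] f (*-cong[] (+-cong[] f ≈[]-refl)
  (+-cong[] (+-cong[] ≈[]-refl (*-cong[] e (+-cong[] f ≈[]-refl))) (*-cong[] ≈[]-refl g)))

-- Replacing z by z + 1 in the falling product (z - 2)(z - 3)⋯ adds the factor z - 1 in front and
-- drops the last one.
monomial-shift : ∀ j u z → monomial (suc j) u (1# + z) ≐ u * (z + - 1#) * monomial j u z
monomial-shift zero    u z n = lem (approx u n) (approx z n)
  where
  lem : ∀ u z → u ℤ.* u ℤ.* (((+ 1 ℤ.+ z) ℤ.- + 2) ℤ.* ((+ 1 ℤ.+ z) ℤ.- + 3)) ℤ.* (u ℤ.* ((+ 1 ℤ.+ z) ℤ.- (+ 4 ℤ.+ + 0)))
        ≡ u ℤ.* (z ℤ.- + 1) ℤ.* (u ℤ.* u ℤ.* ((z ℤ.- + 2) ℤ.* (z ℤ.- + 3)))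
  lem = solve-∀
monomial-shift (suc j) u z n =
  trans (cong (ℤ._* approx (u * ((1# + z) + - (fromℕ 4 + fromℕ (suc j)))) n) (monomial-shift j u z n))
    (lem (approx u n) (approx z n) (+ j) (approx (monomial j u z) n))
  where
  lem : ∀ u z j m → u ℤ.* (z ℤ.- + 1) ℤ.* m ℤ.* (u ℤ.* ((+ 1 ℤ.+ z) ℤ.- (+ 4 ℤ.+ (+ 1 ℤ.+ j))))
        ≡ u ℤ.* (z ℤ.- + 1) ℤ.* (m ℤ.* (u ℤ.* (z ℤ.- (+ 4 ℤ.+ j))))
  lem = solve-∀

-- Pascal's rule for binomial coefficients in z, scaled by the coefficients of the series.
term-recurrence : ∀ k u z →
  (1# + z) * (z * (coefficient (suc k) * monomial (suc k) u (1# + z))) ≈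
  z * ((z + - 1#) * (coefficient (suc k) * monomial (suc k) u z)) +
  fromℕ 3 * u * (z * ((z + - 1#) * (coefficient k * monomial k u z)))
term-recurrence k u z = linear-combination₂
  (≐⇒≈ {monomial (suc k) u (1# + z)} {u * (z + - 1#) * monomial k u z} (monomial-shift k u z))
  (coefficient-suc k)
  ((1# + z) * (z * coefficient (suc k))) (u * z * (z + - 1#) * monomial k u z)
  λ n → lem (approx u n) (approx z n) (+ k) (approx (monomial k u z) n)
            (approx (monomial (suc k) u (1# + z)) n) (approx (coefficient k) n) (approx (coefficient (suc k)) n)
  where
  lem : ∀ u z k m m′ r r′ →
    (+ 1 ℤ.+ z) ℤ.* (z ℤ.* (r′ ℤ.* m′)) ℤ.-
    (z ℤ.* ((z ℤ.- + 1) ℤ.* (r′ ℤ.* (m ℤ.* (u ℤ.* (z ℤ.- (+ 4 ℤ.+ k)))))) ℤ.+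
     + 3 ℤ.* u ℤ.* (z ℤ.* ((z ℤ.- + 1) ℤ.* (r ℤ.* m)))) ≡
    (+ 1 ℤ.+ z) ℤ.* (z ℤ.* r′) ℤ.* (m′ ℤ.- u ℤ.* (z ℤ.- + 1) ℤ.* m) ℤ.+
    u ℤ.* z ℤ.* (z ℤ.- + 1) ℤ.* m ℤ.* ((+ 5 ℤ.+ k) ℤ.* r′ ℤ.- + 3 ℤ.* r)
  lem = solve-∀

-- Pascal's rule lowers the index by one, so the last sum has one term fewer and the identity is
-- exact for truncations. The summand `2 z` comes from the leading term, as (z + 1) z - z (z - 1) =
-- 2z; `coefficient-zero` links the term with index 3 to the first term of the series.
T-recurrence-partial : ∀ k u z →
  T u (1# + z) (partialSum (suc k) u (1# + z)) ≈
  T u z (partialSum (suc k) u z) + (fromℕ 2 * z + fromℕ 3 * u * T u z (partialSum k u z))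
T-recurrence-partial zero u z = linear-combination coefficient-zero
  (fromℕ 3 * u * u * z * (z + - 1#) * (z + - fromℕ 2))
  λ n → lem (approx u n) (approx z n) (approx (coefficient 0) n)
  where
  lem : ∀ u z r →
    (+ 1 ℤ.+ z) ℤ.* (((+ 1 ℤ.+ z) ℤ.- + 1) ℤ.* (+ 1 ℤ.+ u ℤ.* ((+ 1 ℤ.+ z) ℤ.- + 2) ℤ.+ + 3 ℤ.*
      (+ 0 ℤ.+ r ℤ.* (u ℤ.* u ℤ.* (((+ 1 ℤ.+ z) ℤ.- + 2) ℤ.* ((+ 1 ℤ.+ z) ℤ.- + 3)))))) ℤ.-
    (z ℤ.* ((z ℤ.- + 1) ℤ.* (+ 1 ℤ.+ u ℤ.* (z ℤ.- + 2) ℤ.+ + 3 ℤ.*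
      (+ 0 ℤ.+ r ℤ.* (u ℤ.* u ℤ.* ((z ℤ.- + 2) ℤ.* (z ℤ.- + 3)))))) ℤ.+
     (+ 2 ℤ.* z ℤ.+ + 3 ℤ.* u ℤ.* (z ℤ.* ((z ℤ.- + 1) ℤ.* (+ 1 ℤ.+ u ℤ.* (z ℤ.- + 2) ℤ.+ + 3 ℤ.* + 0))))) ≡
    + 3 ℤ.* u ℤ.* u ℤ.* z ℤ.* (z ℤ.- + 1) ℤ.* (z ℤ.- + 2) ℤ.* (+ 4 ℤ.* r ℤ.- + 1)
  lem = solve-∀
T-recurrence-partial (suc k) u z = linear-combination₂ (T-recurrence-partial k u z) (term-recurrence k u z) 1# (fromℕ 3)
  λ n → lem (approx u n) (approx z n) (approx (partialSum (suc k) u (1# + z)) n)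
            (approx (partialSum (suc k) u z) n) (approx (partialSum k u z) n)
            (approx (coefficient (suc k) * monomial (suc k) u (1# + z)) n)
            (approx (coefficient (suc k) * monomial (suc k) u z) n)
            (approx (coefficient k * monomial k u z) n)
  where
  lem : ∀ u z p q s a b c →
    (+ 1 ℤ.+ z) ℤ.* (((+ 1 ℤ.+ z) ℤ.- + 1) ℤ.* (+ 1 ℤ.+ u ℤ.* ((+ 1 ℤ.+ z) ℤ.- + 2) ℤ.+ + 3 ℤ.* (p ℤ.+ a))) ℤ.-
    (z ℤ.* ((z ℤ.- + 1) ℤ.* (+ 1 ℤ.+ u ℤ.* (z ℤ.- + 2) ℤ.+ + 3 ℤ.* (q ℤ.+ b))) ℤ.+
     (+ 2 ℤ.* z ℤ.+ + 3 ℤ.* u ℤ.* (z ℤ.* ((z ℤ.- + 1) ℤ.* (+ 1 ℤ.+ u ℤ.* (z ℤ.- + 2) ℤ.+ + 3 ℤ.* (s ℤ.+ c)))))) ≡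
    + 1 ℤ.* 
    ((+ 1 ℤ.+ z) ℤ.* (((+ 1 ℤ.+ z) ℤ.- + 1) ℤ.* (+ 1 ℤ.+ u ℤ.* ((+ 1 ℤ.+ z) ℤ.- + 2) ℤ.+ + 3 ℤ.* p)) ℤ.-
     (z ℤ.* ((z ℤ.- + 1) ℤ.* (+ 1 ℤ.+ u ℤ.* (z ℤ.- + 2) ℤ.+ + 3 ℤ.* q)) ℤ.+
      (+ 2 ℤ.* z ℤ.+ + 3 ℤ.* u ℤ.* (z ℤ.* ((z ℤ.- + 1) ℤ.* (+ 1 ℤ.+ u ℤ.* (z ℤ.- + 2) ℤ.+ + 3 ℤ.* s)))))) ℤ.+
    + 3 ℤ.* ((+ 1 ℤ.+ z) ℤ.* (z ℤ.* a) ℤ.-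
      (z ℤ.* ((z ℤ.- + 1) ℤ.* b) ℤ.+ + 3 ℤ.* u ℤ.* (z ℤ.* ((z ℤ.- + 1) ℤ.* c))))
  lem = solve-∀

-- For q = 1 + 3u with u nonzero this is 2 (ι_q(z) - z) / (3u); its recurrence below mirrors ι_q(z +
-- 1) = 1 + q ι_q(z).
T∞ : ℤ₃ → ℤ₃ → ℤ₃
T∞ u z = T u z (remainder u z)

T∞-cong[] : ∀ {n} u {z w} → z ≈[ n ] w → T∞ u z ≈[ n ] T∞ u w
T∞-cong[] u e = T-cong[] (≈[]-refl {x = u}) e (remainder-cong[] (≈[]-refl {x = u}) e)

T∞-recurrence : ∀ u z → T∞ u (1# + z) ≈ T∞ u z + (fromℕ 2 * z + fromℕ 3 * u * T∞ u z)
T∞-recurrence u z = ≈[]⇒≈ λ n →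
  -- Truncations of lengths `n * 2` and `1 + n * 2` are both correct modulo 3ⁿ, so the exact finite
  -- recurrence passes to the limit.
  let truncate : ∀ d w → T∞ u w ≈[ n ] T u w (partialSum (d ℕ.+ n ℕ.* 2) u w)
      truncate d w = T-cong[] (≈[]-refl {x = u}) (≈[]-refl {x = w}) (remainder-partialSum n d u w)
  in ≈[]-trans (truncate 1 (1# + z))
       (≈[]-trans (≈⇒≈[] (T-recurrence-partial (n ℕ.* 2) u z))
         (≈[]-sym (+-cong[] (truncate 1 z)
           (+-cong[] (≈[]-refl {x = fromℕ 2 * z}) (*-cong[] (≈[]-refl {x = fromℕ 3 * u}) (truncate 0 z))))))

-- The expansion of ι_q(z) - z

^-geom : ∀ {q u} → q ≈ 1# + fromℕ 3 * u → ∀ N → q ^₃ N ≈ 1# + fromℕ 3 * u * geom q N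
^-geom {q} {u} e zero = ≐⇒≈ λ n → lem (approx u n)
  where
  lem : ∀ u → + 1 ≡ + 1 ℤ.+ + 3 ℤ.* u ℤ.* + 0
  lem = solve-∀
^-geom {q} {u} e (suc N) = linear-combination₂ e (^-geom e N) (q ^₃ N) 1#
  λ n → lem (approx q n) (approx u n) (approx (geom q N) n) (approx (q ^₃ N) n)
  where
  lem : ∀ q u g p → q ℤ.* p ℤ.- (+ 1 ℤ.+ + 3 ℤ.* u ℤ.* (g ℤ.+ p)) ≡
        p ℤ.* (q ℤ.- (+ 1 ℤ.+ + 3 ℤ.* u)) ℤ.+ + 1 ℤ.* (p ℤ.- (+ 1 ℤ.+ + 3 ℤ.* u ℤ.* g))
  lem = solve-∀

geom-T∞ : ∀ {q u} → q ≈ 1# + fromℕ 3 * u → ∀ N →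
          fromℕ 2 * geom q N ≈ fromℕ 2 * fromℕ N + fromℕ 3 * u * T∞ u (fromℕ N)
geom-T∞ {q} {u} e zero = ≐⇒≈ λ n → lem (approx u n) (approx ((0# + - 1#) * G u 0#) n)
  where
  lem : ∀ u x → + 2 ℤ.* + 0 ≡ + 2 ℤ.* + 0 ℤ.+ + 3 ℤ.* u ℤ.* (+ 0 ℤ.* x)
  lem = solve-∀
geom-T∞ {q} {u} e (suc N) = ≈-trans
  (linear-combination₂ {y = fromℕ 2 * fromℕ (suc N) + fromℕ 3 * u * T′} (^-geom e N) (geom-T∞ e N)
    (fromℕ 2) (1# + fromℕ 3 * u)
    λ n → lem (approx u n) (+ N) (approx (geom q N) n) (approx (q ^₃ N) n) (approx (T∞ u (fromℕ N)) n))
  (+-cong (≈-refl {fromℕ 2 * fromℕ (suc N)}) (*-cong (≈-refl {fromℕ 3 * u}) (≈-sym T-suc)))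
  where
  T′ : ℤ₃
  T′ = T∞ u (fromℕ N) + (fromℕ 2 * fromℕ N + fromℕ 3 * u * T∞ u (fromℕ N))
  T-suc : T∞ u (fromℕ (suc N)) ≈ T′
  T-suc = ≈-trans
    (nonexpansive-cong (T∞-cong[] u) (≐⇒≈ {fromℕ (suc N)} {1# + fromℕ N} λ _ → refl))
    (T∞-recurrence u (fromℕ N))
  lem : ∀ u N g p t →
    + 2 ℤ.* (g ℤ.+ p) ℤ.- (+ 2 ℤ.* (+ 1 ℤ.+ N) ℤ.+ + 3 ℤ.* u ℤ.* (t ℤ.+ (+ 2 ℤ.* N ℤ.+ + 3 ℤ.* u ℤ.* t))) ≡
    + 2 ℤ.* (p ℤ.- (+ 1 ℤ.+ + 3 ℤ.* u ℤ.* g)) ℤ.+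
    (+ 1 ℤ.+ + 3 ℤ.* u) ℤ.* (+ 2 ℤ.* g ℤ.- (+ 2 ℤ.* N ℤ.+ + 3 ℤ.* u ℤ.* t))
  lem = solve-∀

-- Both sides respect congruence modulo 3ⁿ in `z`, so `z` may be replaced by its natural residue,
-- where `geom-T∞` applies.
ι-T∞ : ∀ {q u} q∈U → q ≈ 1# + fromℕ 3 * u → ∀ z →
       fromℕ 2 * ι q q∈U z ≈ fromℕ 2 * z + fromℕ 3 * u * T∞ u z
ι-T∞ {q} {u} q∈U e z = ≈[]⇒≈ λ n →
  let N : ℕ
      N = approx z n mod3^ n
      N≈z : fromℕ N ≈[ n ] z
      N≈z = mk≈[] (mod3^-≡ₙ n (approx z n))
      ιN≈ιz : ι q q∈U (fromℕ N) ≈[ n ] ι q q∈U z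
      ιN≈ιz = mk≈[] (ι-ball q q∈U z (fromℕ N) n (at-level N≈z))
  in ≈[]-trans (*-cong[] (≈[]-refl {x = fromℕ 2})
         (≈[]-trans (≈[]-sym ιN≈ιz) (≈⇒≈[] (ι-fromℕ q q∈U N))))
       (≈[]-trans (≈⇒≈[] (geom-T∞ e N))
         (+-cong[] (*-cong[] (≈[]-refl {x = fromℕ 2}) N≈z)
                   (*-cong[] (≈[]-refl {x = fromℕ 3 * u}) (T∞-cong[] u N≈z))))

-- Fixed points as roots of G

fixed⇒G≈0 : ∀ {q u z} q∈U → q ≈ 1# + fromℕ 3 * u → ¬ u ≈ 0# →
            NontrivialFixedPoint q q∈U z → G u z ≈ 0#
fixed⇒G≈0 {q} {u} {z} q∈U e u≉0 (fixed , z≉0 , z≉1) =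
  -- At a fixed point 3 u z (z - 1) G(u, z) = 0, and the nonzero factors are cancelled one by one.
  x*y≈0⇒y≈0 (λ z-1≈0 → z≉1 (difference≈0⁻¹ z-1≈0))
    (x*y≈0⇒y≈0 z≉0 (x*y≈0⇒y≈0 u≉0 (x*y≈0⇒y≈0 (fromℕ≉0 3)
      (linear-combination₂ (ι-T∞ q∈U e z) fixed (- 1#) (fromℕ 2)
        λ n → lem (approx u n) (approx z n) (approx (T∞ u z) n) (approx (ι q q∈U z) n)))))
  where
  lem : ∀ u z t i → + 3 ℤ.* (u ℤ.* t) ℤ.- + 0 ≡
    (ℤ.- + 1) ℤ.* (+ 2 ℤ.* i ℤ.- (+ 2 ℤ.* z ℤ.+ + 3 ℤ.* u ℤ.* t)) ℤ.+ + 2 ℤ.* (i ℤ.- z)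
  lem = solve-∀

G≈0⇒fixed : ∀ {q u z} q∈U → q ≈ 1# + fromℕ 3 * u → G u z ≈ 0# → ι q q∈U z ≈ z
G≈0⇒fixed {q} {u} {z} q∈U e G≈0 = *-cancelˡ-≈ (fromℕ≉0 2)
  (linear-combination₂ (ι-T∞ q∈U e z) G≈0 1# (fromℕ 3 * u * (z * (z + - 1#)))
    λ n → lem (approx u n) (approx z n) (approx (G u z) n) (approx (ι q q∈U z) n))
  where
  lem : ∀ u z g i → + 2 ℤ.* i ℤ.- + 2 ℤ.* z ≡
    + 1 ℤ.* (+ 2 ℤ.* i ℤ.- (+ 2 ℤ.* z ℤ.+ + 3 ℤ.* u ℤ.* (z ℤ.* ((z ℤ.- + 1) ℤ.* g)))) ℤ.+
    + 3 ℤ.* u ℤ.* (z ℤ.* (z ℤ.- + 1)) ℤ.* (g ℤ.- + 0)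
  lem = solve-∀

-- The residue class u ∈ c + 3ℤ₃ with c a unit modulo 3.  Modulo 3 the equation
-- G(u, z) = 0 reads 1 + c (z - 2) = 0, with solution τ = 2 - c.
module ResidueClass (c h : ℤ) (c²≡1+3h : c ℤ.* c ≡ + 1 ℤ.+ + 3 ℤ.* h) where

  C H τ : ℤ₃
  C = fromℤ c
  H = fromℤ h
  τ = fromℤ (+ 2 ℤ.- c)

  u : ℤ₃ → ℤ₃
  u s = C + fromℕ 3 * s

  -- `C` is its own inverse modulo 3, so multiplying G = 0 by `C` isolates the unknown up to
  -- multiples of 3.
  C² : C * C ≈ 1# + fromℕ 3 * H
  C² = ≐⇒≈ λ _ → c²≡1+3h

  u≉0 : ∀ s → ¬ u s ≈ 0#
  u≉0 s e = 1+3x≉0 (H + C * s) (linear-combination₂ e C² C (- 1#) λ n → lem c h (approx s n))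
    where
    lem : ∀ c h s → (+ 1 ℤ.+ + 3 ℤ.* (h ℤ.+ c ℤ.* s)) ℤ.- + 0 ≡
      c ℤ.* ((c ℤ.+ + 3 ℤ.* s) ℤ.- + 0) ℤ.+ (ℤ.- + 1) ℤ.* (c ℤ.* c ℤ.- (+ 1 ℤ.+ + 3 ℤ.* h))
    lem = solve-∀

  C≉0 : ¬ C ≈ 0#
  C≉0 e = u≉0 0# (≈-trans (≐⇒≈ λ _ → ℤ.+-identityʳ c) e)

  module Root (s : ℤ₃) where

    -- Multiplying G(u, z) = 0 by `C` and replacing `C * C` by 1 + 3H gives z = (2 - C) + 3 f(z).
    f : ℤ₃ → ℤ₃
    f z = - (H * (z + - fromℕ 2) + (C * s * (z + - fromℕ 2) + C * remainder (u s) z))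

    f-nonexpansive : Nonexpansive f
    f-nonexpansive e = -‿cong[] (+-cong[] (*-cong[] (≈[]-refl {x = H}) z-2)
      (+-cong[] (*-cong[] (≈[]-refl {x = C * s}) z-2)
                (*-cong[] (≈[]-refl {x = C}) (remainder-cong[] (≈[]-refl {x = u s}) e))))
      where
      z-2 = +-cong[] e (≈[]-refl {x = - fromℕ 2})

    open Contraction τ {f} f-nonexpansive public

    G≈0⇒step : ∀ {z} → G (u s) z ≈ 0# → z ≈ step z
    G≈0⇒step {z} e = linear-combination₂ e C² C (- (z + - fromℕ 2))
      λ n → lem c h (approx s n) (approx z n) (approx (remainder (u s) z) n)
      where
      lem : ∀ c h s z r →
        z ℤ.- ((+ 2 ℤ.- c) ℤ.+ + 3 ℤ.* (ℤ.- (h ℤ.* (z ℤ.- + 2) ℤ.+ (c ℤ.* s ℤ.* (z ℤ.- + 2) ℤ.+ c ℤ.* r)))) ≡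
        c ℤ.* ((+ 1 ℤ.+ (c ℤ.+ + 3 ℤ.* s) ℤ.* (z ℤ.- + 2) ℤ.+ + 3 ℤ.* r) ℤ.- + 0) ℤ.+
        (ℤ.- (z ℤ.- + 2)) ℤ.* (c ℤ.* c ℤ.- (+ 1 ℤ.+ + 3 ℤ.* h))
      lem = solve-∀

    step⇒G≈0 : ∀ {z} → z ≈ step z → G (u s) z ≈ 0#
    step⇒G≈0 {z} e = x*y≈0⇒y≈0 C≉0 (linear-combination₂ e C² 1# (z + - fromℕ 2)
      λ n → lem c h (approx s n) (approx z n) (approx (remainder (u s) z) n))
      where
      lem : ∀ c h s z r →
        c ℤ.* (+ 1 ℤ.+ (c ℤ.+ + 3 ℤ.* s) ℤ.* (z ℤ.- + 2) ℤ.+ + 3 ℤ.* r) ℤ.- + 0 ≡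
        + 1 ℤ.* (z ℤ.- ((+ 2 ℤ.- c) ℤ.+ + 3 ℤ.* (ℤ.- (h ℤ.* (z ℤ.- + 2) ℤ.+ (c ℤ.* s ℤ.* (z ℤ.- + 2) ℤ.+ c ℤ.* r))))) ℤ.+
        (z ℤ.- + 2) ℤ.* (c ℤ.* c ℤ.- (+ 1 ℤ.+ + 3 ℤ.* h))
      lem = solve-∀

    root : ∃ λ z → G (u s) z ≈ 0# × z ∈ τ +⟨ 3 ⟩
    root with fixed-point
    ... | z , e = z , step⇒G≈0 e , f z , e

    root-unique : ∀ {z w} → G (u s) z ≈ 0# → G (u s) w ≈ 0# → z ≈ w
    root-unique e e′ = fixed-point-unique (G≈0⇒step e) (G≈0⇒step e′)

  module Parameter where

    -- At z = τ the factor z - 2 is `- C`; multiplying G(v, τ) = 0 by `C` gives v = C + 3 f(v).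
    f : ℤ₃ → ℤ₃
    f v = C * remainder v τ + - (H * v)

    f-nonexpansive : Nonexpansive f
    f-nonexpansive e = +-cong[] (*-cong[] (≈[]-refl {x = C}) (remainder-cong[] e (≈[]-refl {x = τ})))
      (-‿cong[] (*-cong[] (≈[]-refl {x = H}) e))

    open Contraction C {f} f-nonexpansive public

    G≈0⇒step : ∀ {v} → G v τ ≈ 0# → v ≈ step v
    G≈0⇒step {v} e = linear-combination₂ e C² (- C) (- v)
      λ n → lem c h (approx v n) (approx (remainder v τ) n)
      where
      lem : ∀ c h v r → v ℤ.- (c ℤ.+ + 3 ℤ.* (c ℤ.* r ℤ.- h ℤ.* v)) ≡
        (ℤ.- c) ℤ.* ((+ 1 ℤ.+ v ℤ.* ((+ 2 ℤ.- c) ℤ.- + 2) ℤ.+ + 3 ℤ.* r) ℤ.- + 0) ℤ.+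
        (ℤ.- v) ℤ.* (c ℤ.* c ℤ.- (+ 1 ℤ.+ + 3 ℤ.* h))
      lem = solve-∀

    step⇒G≈0 : ∀ {v} → v ≈ step v → G v τ ≈ 0#
    step⇒G≈0 {v} e = x*y≈0⇒y≈0 C≉0 (linear-combination₂ e C² (- 1#) (- v)
      λ n → lem c h (approx v n) (approx (remainder v τ) n))
      where
      lem : ∀ c h v r →
        c ℤ.* (+ 1 ℤ.+ v ℤ.* ((+ 2 ℤ.- c) ℤ.- + 2) ℤ.+ + 3 ℤ.* r) ℤ.- + 0 ≡
        (ℤ.- + 1) ℤ.* (v ℤ.- (c ℤ.+ + 3 ℤ.* (c ℤ.* r ℤ.- h ℤ.* v))) ℤ.+
        (ℤ.- v) ℤ.* (c ℤ.* c ℤ.- (+ 1 ℤ.+ + 3 ℤ.* h))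
      lem = solve-∀

    parameter : ∃ λ s → G (u s) τ ≈ 0#
    parameter with fixed-point
    -- `v` equals C + 3 f(v), which is `u (f v)`.
    ... | v , e = f v , ≈-trans (≈-sym (G-cong e (≈-refl {τ}))) (step⇒G≈0 e)

    parameter-unique : ∀ {v w} → G v τ ≈ 0# → G w τ ≈ 0# → v ≈ w
    parameter-unique e e′ = fixed-point-unique (G≈0⇒step e) (G≈0⇒step e′)

  -- Conclusions for one class of q modulo 9

  a : ℤ₃
  a = fromℤ (+ 1 ℤ.+ + 3 ℤ.* c)

  coset⇒u : ∀ {q} → q ∈ a +⟨ 9 ⟩ → ∃ λ s → q ≈ 1# + fromℕ 3 * u s
  coset⇒u (s , e) = s , ≈-trans e (≐⇒≈ λ n → lem c (approx s n))
    where
    lem : ∀ c s → (+ 1 ℤ.+ + 3 ℤ.* c) ℤ.+ + 9 ℤ.* s ≡ + 1 ℤ.+ + 3 ℤ.* (c ℤ.+ + 3 ℤ.* s)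
    lem = solve-∀

  u⇒coset : ∀ {q s} → q ≈ 1# + fromℕ 3 * u s → q ∈ a +⟨ 9 ⟩
  u⇒coset {s = s} e = s , ≈-trans e (≐⇒≈ λ n → lem c (approx s n))
    where
    lem : ∀ c s → + 1 ℤ.+ + 3 ℤ.* (c ℤ.+ + 3 ℤ.* s) ≡ (+ 1 ℤ.+ + 3 ℤ.* c) ℤ.+ + 9 ℤ.* s
    lem = solve-∀

  ∈U1∖U2 : ∀ {q s} → q ≈ 1# + fromℕ 3 * u s → q ∈ U 1 ∖ U 2
  -- If also q = 1 + 9t, then 3 (c + 3 (s - t)) = 0, against `u≉0`.
  ∈U1∖U2 {q} {s} e = (u s , e) , λ (t , e′) → u≉0 (s + - t)
    (x*y≈0⇒y≈0 (fromℕ≉0 3) (linear-combination₂ e e′ (- 1#) 1#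
      λ n → lem (approx q n) c (approx s n) (approx t n)))
    where
    lem : ∀ q c s t → + 3 ℤ.* (c ℤ.+ + 3 ℤ.* (s ℤ.- t)) ℤ.- + 0 ≡
      (ℤ.- + 1) ℤ.* (q ℤ.- (+ 1 ℤ.+ + 3 ℤ.* (c ℤ.+ + 3 ℤ.* s))) ℤ.+ + 1 ℤ.* (q ℤ.- (+ 1 ℤ.+ + 9 ℤ.* t))
    lem = solve-∀

  -- The hypotheses say that τ is 0 or 1 and that the other trivial point lies outside τ + 3ℤ₃.
  module Conclusion
    (τ-trivial : ∀ {z} → ¬ z ≈ 0# → ¬ z ≈ 1# → ¬ z ≈ τ)
    (τ-only : ∀ {z} → z ∈ τ +⟨ 3 ⟩ → ¬ z ≈ τ → ¬ z ≈ 0# × ¬ z ≈ 1#)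
    where

    -- Here τ is the only root of G(u, ·), so a nontrivial fixed point would equal the trivial point
    -- τ.
    exceptional-if : ∀ {q s} → q ≈ 1# + fromℕ 3 * u s → G (u s) τ ≈ 0# → NoNontrivialFixedPoint q
    exceptional-if {s = s} e Gτ≈0 = (u s , e) , λ (z , z-nontrivial@(_ , z≉0 , z≉1)) →
      τ-trivial z≉0 z≉1 (Root.root-unique s (fixed⇒G≈0 (u s , e) e (u≉0 s) z-nontrivial) Gτ≈0)

    root-fixed : ∀ {q s} (q∈U : q ∈ U 1) → q ≈ 1# + fromℕ 3 * u s → ¬ G (u s) τ ≈ 0# →
                 ∃ λ z → (G (u s) z ≈ 0# × z ∈ τ +⟨ 3 ⟩) × NontrivialFixedPoint q q∈U z
    root-fixed {s = s} q∈U e Gτ≉0 =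
      let (z , Gz≈0 , z∈) = Root.root s
      in z , (Gz≈0 , z∈) , G≈0⇒fixed q∈U e Gz≈0 ,
         τ-only z∈ λ z≈τ → Gτ≉0 (≈-trans (G-cong (≈-refl {u s}) (≈-sym z≈τ)) Gz≈0)

    -- Otherwise the root of G(u, ·) would be a nontrivial fixed point; stability of equality
    -- removes the double negation.
    exceptional-only-if : ∀ {q s} → q ≈ 1# + fromℕ 3 * u s → NoNontrivialFixedPoint q → G (u s) τ ≈ 0#
    exceptional-only-if e (q∈U , none) = ≈-stable λ Gτ≉0 →
      let (z , _ , z-nontrivial) = root-fixed q∈U e Gτ≉0 in none (z , z-nontrivial)

    q∗ : ℤ₃
    q∗ = 1# + fromℕ 3 * u (proj₁ Parameter.parameter)

    q∗-unique : ∀ {q} → q ∈ a +⟨ 9 ⟩ → NoNontrivialFixedPoint q → q∗ ≈ q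
    q∗-unique q∈a none =
      let (s , e) = coset⇒u q∈a
      in ≈-trans (+-cong (≈-refl {1#}) (*-cong (≈-refl {fromℕ 3})
                   (Parameter.parameter-unique (proj₂ Parameter.parameter) (exceptional-only-if e none))))
                 (≈-sym e)

    exceptional : ∃! _≈_ λ q → q ∈ U 1 ∖ U 2 × q ∈ a +⟨ 9 ⟩ × q ∈ NoNontrivialFixedPoint
    exceptional = q∗ ,
      (∈U1∖U2 q∗≈ , u⇒coset q∗≈ , exceptional-if q∗≈ (proj₂ Parameter.parameter)) ,
      λ (_ , q∈a , none) → q∗-unique q∈a none
      where
      q∗≈ : q∗ ≈ 1# + fromℕ 3 * u (proj₁ Parameter.parameter)
      q∗≈ = ≈-refl

    nonexceptional : ∀ {q} q∈U → q ∈ a +⟨ 9 ⟩ → ¬ q ≈ q∗ →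
                     Σ (∃! _≈_ (NontrivialFixedPoint q q∈U)) λ (z , _) → z ∈ τ +⟨ 3 ⟩
    nonexceptional {q} q∈U q∈a q≉ =
      let (s , e) = coset⇒u q∈a
          -- G(u, τ) = 0 would make q exceptional and hence equal to `q∗`.
          (z , (Gz≈0 , z∈) , z-nontrivial) = root-fixed q∈U e λ Gτ≈0 →
            q≉ (≈-sym (q∗-unique q∈a (exceptional-if e Gτ≈0)))
      in (z , z-nontrivial , λ w-nontrivial →
            Root.root-unique s Gz≈0 (fixed⇒G≈0 q∈U e (u≉0 s) w-nontrivial)) , z∈

-- The classes of 4 and 7 modulo 9

module Class4 = ResidueClass (+ 1) (+ 0) refl
module Class7 = ResidueClass (+ 2) (+ 1) refl

1+3t≉0 : ∀ {z t} → z ≈ 1# + fromℕ 3 * t → ¬ z ≈ 0#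
1+3t≉0 {t = t} e z≈0 = 1+3x≉0 t (≈-trans (≈-sym e) z≈0)

3t≉1 : ∀ {z t} → z ≈ 0# + fromℕ 3 * t → ¬ z ≈ 1#
3t≉1 {z} {t} e z≈1 = 1+3x≉0 (- t) (linear-combination₂ e z≈1 1# (- 1#)
  λ n → lem (approx z n) (approx t n))
  where
  lem : ∀ z t → (+ 1 ℤ.+ + 3 ℤ.* (ℤ.- t)) ℤ.- + 0 ≡
    + 1 ℤ.* (z ℤ.- (+ 0 ℤ.+ + 3 ℤ.* t)) ℤ.+ (ℤ.- + 1) ℤ.* (z ℤ.- + 1)
  lem = solve-∀

-- τ = 2 - c is 1 for c = 1 and 0 for c = 2, and the other trivial point is excluded modulo 3.
module Conclusion4 = Class4.Conclusion (λ z≉0 z≉1 → z≉1) (λ (_ , e) z≉1 → 1+3t≉0 e , z≉1)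
module Conclusion7 = Class7.Conclusion (λ z≉0 z≉1 → z≉0) (λ (_ , e) z≉0 → z≉0 , 3t≉1 e)

U1∖U2⇒4∨7 : ∀ {q} → q ∈ U 1 → ¬ q ∈ U 2 → q ∈ fromℕ 4 +⟨ 9 ⟩ ⊎ q ∈ fromℕ 7 +⟨ 9 ⟩
-- With q = 1 + 3t the residue of t modulo 3 decides; residue 0 would put q into U⁽²⁾.
U1∖U2⇒4∨7 {q} (t , q≈) q∉U2 =
  residue (approx t 1 mod3^ 1) (n%ℕd<d (approx t 1) 3)
    (≡ₙ⇒∈coset {1} {fromℕ (approx t 1 mod3^ 1)} {t} (≡ₙ-sym (mod3^-≡ₙ 1 (approx t 1))))
  where
  coset : ∀ r s → t ≈ r + fromℕ 3 * s → q ≈ (1# + fromℕ 3 * r) + fromℕ 9 * s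
  coset r s t≈ = linear-combination₂ q≈ t≈ 1# (fromℕ 3)
    λ n → lem (approx q n) (approx t n) (approx r n) (approx s n)
    where
    lem : ∀ q t r s → q ℤ.- ((+ 1 ℤ.+ + 3 ℤ.* r) ℤ.+ + 9 ℤ.* s) ≡
      + 1 ℤ.* (q ℤ.- (+ 1 ℤ.+ + 3 ℤ.* t)) ℤ.+ + 3 ℤ.* (t ℤ.- (r ℤ.+ + 3 ℤ.* s))
    lem = solve-∀
  residue : ∀ r → r ℕ.< 3 → t ∈ fromℕ r +⟨ 3 ⟩ → q ∈ fromℕ 4 +⟨ 9 ⟩ ⊎ q ∈ fromℕ 7 +⟨ 9 ⟩
  residue 0 _ (s , t≈) = ⊥-elim (q∉U2 (s , ≈-trans (coset 0# s t≈) (≐⇒≈ λ _ → refl)))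
  residue 1 _ (s , t≈) = inj₁ (s , ≈-trans (coset 1# s t≈) (≐⇒≈ λ _ → refl))
  residue 2 _ (s , t≈) = inj₂ (s , ≈-trans (coset (fromℕ 2) s t≈) (≐⇒≈ λ _ → refl))
  residue (suc (suc (suc _))) (s≤s (s≤s (s≤s ()))) _

4∧7-disjoint : ∀ {q} → q ∈ fromℕ 4 +⟨ 9 ⟩ → ¬ q ∈ fromℕ 7 +⟨ 9 ⟩
4∧7-disjoint {q} (s , e) (t , e′) = 1+3x≉0 (t + - s) (x*y≈0⇒y≈0 (fromℕ≉0 3)
  (linear-combination₂ e e′ 1# (- 1#) λ n → lem (approx q n) (approx s n) (approx t n)))
  where
  lem : ∀ q s t → + 3 ℤ.* (+ 1 ℤ.+ + 3 ℤ.* (t ℤ.- s)) ℤ.- + 0 ≡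
    + 1 ℤ.* (q ℤ.- (+ 4 ℤ.+ + 9 ℤ.* s)) ℤ.+ (ℤ.- + 1) ℤ.* (q ℤ.- (+ 7 ℤ.+ + 9 ℤ.* t))
  lem = solve-∀

mainTheorem1 : Σ (∃! _≈_ λ q → q ∈ U 1 ∖ U 2 × q ∈ fromℕ 7 +⟨ 9 ⟩ × q ∈ NoNontrivialFixedPoint) λ (q₀ , _) →
    Σ (∃! _≈_ λ q → q ∈ U 1 ∖ U 2 × q ∈ fromℕ 4 +⟨ 9 ⟩ × q ∈ NoNontrivialFixedPoint) λ (q₁ , _) →
    ∀ q (q∈U¹ : q ∈ U 1) → ¬ (q ∈ U 2) → ¬ (q ≈ q₀) → ¬ (q ≈ q₁) →
    Σ (∃! _≈_ (NontrivialFixedPoint q q∈U¹)) λ (z , _) →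
    (q ∈ fromℕ 4 +⟨ 9 ⟩ → z ∈ 1# +⟨ 3 ⟩) × (q ∈ fromℕ 7 +⟨ 9 ⟩ → z ∈ 0# +⟨ 3 ⟩)
mainTheorem1 = Conclusion7.exceptional , Conclusion4.exceptional , λ q q∈U¹ q∉U² q≉q₀ q≉q₁ →
  nontrivial {q} q∈U¹ q≉q₀ q≉q₁ (U1∖U2⇒4∨7 {q} q∈U¹ q∉U²)
  where
  nontrivial : ∀ {q} (q∈U¹ : q ∈ U 1) → ¬ q ≈ Conclusion7.q∗ → ¬ q ≈ Conclusion4.q∗ →
    q ∈ fromℕ 4 +⟨ 9 ⟩ ⊎ q ∈ fromℕ 7 +⟨ 9 ⟩ →
    Σ (∃! _≈_ (NontrivialFixedPoint q q∈U¹)) λ (z , _) →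
    (q ∈ fromℕ 4 +⟨ 9 ⟩ → z ∈ 1# +⟨ 3 ⟩) × (q ∈ fromℕ 7 +⟨ 9 ⟩ → z ∈ 0# +⟨ 3 ⟩)
  nontrivial {q} q∈U¹ _ q≉q₁ (inj₁ q∈4) =
    let (unique , z∈) = Conclusion4.nonexceptional {q} q∈U¹ q∈4 q≉q₁
    -- The implication for the other class is vacuous, as the two cosets are disjoint.
    in unique , (λ _ → z∈) , λ q∈7 → ⊥-elim (4∧7-disjoint {q} q∈4 q∈7)
  nontrivial {q} q∈U¹ q≉q₀ _ (inj₂ q∈7) =
    let (unique , z∈) = Conclusion7.nonexceptional {q} q∈U¹ q∈7 q≉q₀
    in unique , (λ q∈4 → ⊥-elim (4∧7-disjoint {q} q∈4 q∈7)) , λ _ → z∈
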